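{- (i) The images in $\mathrm{gr}^{W,L}_{5,3}(\mathcal{MD}^{adm})$ of the admissible brackets of weight $5$ and length $3$ satisfy at least one nontrivial $\mathbb{Q}$-linear relation. (ii) The images in $\mathrm{gr}^{W,L}_{6,3}(\mathcal{MD}^{adm})$ of the admissible brackets of weight $6$ and length $3$ satisfy at least $3$ linearly independent $\mathbb{Q}$-linear relations.
   Context: For integers $r_1,\dots,r_l\ge 0$ and $n\ge 1$ let $\sigma_{r_1,\dots,r_l}(n)=\sum v_1^{r_1}\cdots v_l^{r_l}$, summed over positive integers $u_1>\dots>u_l>0$, $v_1,\dots,v_l>0$ with $u_1v_1+\dots+u_lv_l=n$. For integers $s_1,\dots,s_l\ge1$ the bracket is $[s_1,\dots,s_l]=\frac{1}{(s_1-1)!\cdots(s_l-1)!}\sum_{n>0}\sigma_{s_1-1,\dots,s_l-1}(n)q^n\in\mathbb{Q}[[q]]$, of weight $s_1+\dots+s_l$ and length $l$ ($1$ has weight and length $0$). A bracket is admissible if $s_1>1$. $\mathcal{MD}^{adm}$ is the $\mathbb{Q}$-span of $1$ and all admissible brackets, $\mathrm{Fil}^{W,L}_{k,l}(\mathcal{MD}^{adm})$ the span of $1$ and admissible brackets of weight $\le k$ and length $\le l$, and $\mathrm{gr}^{W,L}_{k,l}(\mathcal{MD}^{adm})=\mathrm{Fil}^{W,L}_{k,l}(\mathcal{MD}^{adm})\big/\big(\mathrm{Fil}^{W,L}_{k-1,l}(\mathcal{MD}^{adm})+\mathrm{Fil}^{W,L}_{k,l-1}(\mathcal{MD}^{adm})\big)$.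 -}

module Defs where

open import Data.Nat as ℕ using (ℕ; zero; suc; _≤_; _∸_; _^_; _!; _≤ᵇ_)
open import Data.Nat.Properties using (_!≢0)
import Data.Nat.Properties as ℕP
open import Data.Integer using (+_)
open import Data.Rational as ℚ using (ℚ; 0ℚ; 1ℚ; _/_)
open import Data.Bool using (if_then_else_)
open import Data.List as L using (List; []; _∷_; upTo; map; length)
open import Data.Nat.ListAction using (sum)
open import Data.List.Relation.Unary.All using (All)
open import Data.List.Properties using (≡-dec)
open import Data.Product using (Σ; ∃; _×_; _,_; proj₁; proj₂)
open import Data.Sum using (_⊎_)
open import Data.Empty using (⊥)
open import Relation.Nullary using (yes; no)
open import Relation.Binary.PropositionalEquality using (_≡_)

sumFrom1 : ℕ → (ℕ → ℕ) → ℕ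
sumFrom1 m f = sum (map (λ i → f (suc i)) (upTo m))

-- sigmaAux rs b n = Σ v_1^{r_1} ⋯ v_l^{r_l} over b > u_1 > ⋯ > u_l > 0,
-- v_i > 0, with u_1 v_1 + ⋯ + u_l v_l = n   (rs = r_1 ∷ ⋯ ∷ r_l)
sigmaAux : List ℕ → ℕ → ℕ → ℕ
sigmaAux []       b n = if n ℕ.≡ᵇ 0 then 1 else 0
sigmaAux (r ∷ rs) b n =
  sumFrom1 (b ∸ 1) (λ u → sumFrom1 n (λ v →
    if u ℕ.* v ≤ᵇ n then v ^ r ℕ.* sigmaAux rs u (n ∸ u ℕ.* v) else 0))

-- σ_{r_1,…,r_l}(n)   (u_1 ≤ n automatically, so the bound n + 1 is no restriction)
σ : List ℕ → ℕ → ℕ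
σ rs n = sigmaAux rs (suc n) n

invFact : List ℕ → ℚ
invFact []      = 1ℚ
invFact (s ∷ ss) = ((+ 1) / ((s ∸ 1) !)) {{(s ∸ 1) !≢0}} ℚ.* invFact ss

QSeries : Set
QSeries = ℕ → ℚ

-- The bracket [s_1,…,s_l] (s = s_1 ∷ ⋯ ∷ s_l). For s = [] this gives the
-- series 1 (coefficient 1 at q^0), matching the convention that 1 is the
-- bracket of weight and length 0. For s ≠ [] the q^0 coefficient is 0.
bracket : List ℕ → QSeries
bracket s n = ((+ σ (map (λ x → x ∸ 1) s) n) / 1) ℚ.* invFact s

weight : List ℕ → ℕ
weight = sum

Admissible : List ℕ → Set
Admissible []       = ⊥
Admissible (s ∷ ss) = 2 ≤ s × All (1 ≤_) ss

FilGen : ℕ → ℕ → List ℕ → Set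
FilGen k l s = (s ≡ [] ⊎ Admissible s) × weight s ≤ k × length s ≤ l

LinComb : Set
LinComb = List (ℚ × List ℕ)

eval : LinComb → QSeries
eval []             n = 0ℚ
eval ((c , s) ∷ xs) n = c ℚ.* bracket s n ℚ.+ eval xs n

coeff : LinComb → List ℕ → ℚ
coeff []              t = 0ℚ
coeff ((c , s) ∷ xs) t with ≡-dec ℕ._≟_ s t
... | yes _ = c ℚ.+ coeff xs t
... | no  _ = coeff xs t

InFil : ℕ → ℕ → QSeries → Set
InFil k l f = Σ LinComb λ xs → All (λ p → FilGen k l (proj₂ p)) xs × (∀ n → f n ≡ eval xs n)

InLower : ℕ → ℕ → QSeries → Set
InLower k l f = Σ QSeries λ g → Σ QSeries λ h →
  InFil (k ∸ 1) l g × InFil k (l ∸ 1) h × (∀ n → f n ≡ g n ℚ.+ h n)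

GrRelation : ℕ → ℕ → LinComb → Set
GrRelation k l xs =
  All (λ p → Admissible (proj₂ p) × weight (proj₂ p) ≡ k × length (proj₂ p) ≡ l) xs
  × InLower k l (eval xs)

Nontrivial : LinComb → Set
Nontrivial xs = ∃ λ s → coeff xs s ≡ 0ℚ → ⊥

LinIndep3 : LinComb → LinComb → LinComb → Set
LinIndep3 xs ys zs = ∀ (a b c : ℚ) →
  (∀ s → a ℚ.* coeff xs s ℚ.+ b ℚ.* coeff ys s ℚ.+ c ℚ.* coeff zs s ≡ 0ℚ) →
  a ≡ 0ℚ × b ≡ 0ℚ × c ≡ 0ℚ

{-# OPTIONS --safe #-}

-- The coefficients of a product of a bracket of length 1 and one of length 2 can be expanded in two ways:
-- by comparing the parts u of the two factors, or, after conjugating partitions, by comparing the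
-- multiplicities v. For suitable polynomial weights the two expansions differ by admissible brackets of
-- length 3 and by terms of length 2, some of them polynomial in both u and v and hence
-- not brackets. These are cancelled by the double expansion of a product of two sums of length 1
-- whose weight also depends on u; what is left is a relation modulo admissible brackets of length at most 2.
module Submission where

open import Defs
open import Algebra.Properties.AbelianGroup using () renaming (∙-cancelˡ to cancelˡ)
open import Data.Bool using (if_then_else_)
open import Data.Fin.Patterns using (0F; 1F; 2F; 3F)
open import Data.Integer as ℤ using (ℤ; +_; 0ℤ; 1ℤ; _+_; _*_; _-_; -_; _^_)
import Data.Integer.Properties as ℤP
open import Data.Integer.Solver using () renaming (module +-*-Solver to ℤ-Solver)
open import Data.List using (List; []; _∷_; _∷ʳ_; _++_; upTo; map; length)
open import Data.List.Properties using (upTo-∷ʳ; map-++; ≡-dec)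
open import Data.List.Relation.Unary.All using (All; []; all?)
open import Data.Maybe using (Is-just; to-witness)
open import Data.Maybe.Relation.Unary.Any using (just)
open import Data.Nat as ℕ using (ℕ; zero; suc; pred; _≤_; _<_; z≤n; s≤s; _∸_; _≤ᵇ_; _!)
open import Data.Nat.ListAction using (sum)
open import Data.Nat.ListAction.Properties using (sum-++)
import Data.Nat.Properties as ℕP
open import Data.Nat.Solver using () renaming (module +-*-Solver to ℕ-Solver)
open import Data.Product using (Σ; _×_; _,_; proj₁; proj₂)
open import Data.Rational as ℚ using (ℚ; 0ℚ; 1ℚ; _/_)
import Data.Rational.Properties as ℚP
open import Data.Rational.Solver using () renaming (module +-*-Solver to ℚ-Solver)
open import Data.Rational.Unnormalised as ℚᵘ using (mkℚᵘ; *≡*)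
import Data.Rational.Unnormalised.Properties as ℚᵘP
open import Data.Sum using (inj₁; inj₂)
open import Data.Unit using (tt)
open import Data.Vec as Vec using (Vec; []; _∷_)
open import Relation.Binary.PropositionalEquality
open import Relation.Nullary using (Dec; no)
open import Relation.Nullary.Decidable using (dec-true; dec-false; True; toWitness; _×-dec_; _⊎-dec_)

open ≡-Reasoning

-- Coordinates by gaps turn conjugation into the exchange of (a, b, c) with (x, y, z), and ordered
-- sums over parts into sums over independent positive variables. The obstacle is coinciding parts.
-- In the direct splitting, a weight in the multiplicities alone is summed over all ways to divide a
-- multiplicity, which gives again a polynomial in the multiplicities. After conjugation the weight
-- is constant along that sum, and the number of its terms, `a - 1` or `b - 1`, depends on the
-- parts. A weight `h` of degree at most 1 in `b` on a product of two sums of length 1 produces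
-- terms of the same shape and can absorb them. Everything then becomes a system of polynomial
-- identities, linear in the unknown coefficients. The solutions used here give, modulo admissible
-- brackets of length at most 2, [2,2,1] = 2[3,1,1] in weight 5, and in weight 6 [3,1,2] = 0,
-- [3,2,1] + 2[3,1,2] + [2,3,1] = 3[2,2,2] and 9[4,1,1] = [3,2,1] + 4[3,1,2] + 4[2,3,1].

-- Finite sums over positive integers

∑ : ℕ → (ℕ → ℤ) → ℤ
∑ zero    f = 0ℤ
∑ (suc m) f = ∑ m f + f (suc m)

∑-cong-< : ∀ m {f g : ℕ → ℤ} → (∀ i → i < m → f (suc i) ≡ g (suc i)) → ∑ m f ≡ ∑ m g
∑-cong-< zero    eq = refl
∑-cong-< (suc m) eq = cong₂ _+_ (∑-cong-< m (λ i i<m → eq i (ℕP.m<n⇒m<1+n i<m))) (eq m (ℕP.n<1+n m))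

∑-cong : ∀ m {f g : ℕ → ℤ} → (∀ i → f (suc i) ≡ g (suc i)) → ∑ m f ≡ ∑ m g
∑-cong m eq = ∑-cong-< m (λ i _ → eq i)

+-interchange : ∀ a b c d → (a + b) + (c + d) ≡ (a + c) + (b + d)
+-interchange = solve 4 (λ a b c d → (a :+ b) :+ (c :+ d) := (a :+ c) :+ (b :+ d)) refl
  where open ℤ-Solver

∑-+ : ∀ m (f g : ℕ → ℤ) → ∑ m (λ i → f i + g i) ≡ ∑ m f + ∑ m g
∑-+ zero    f g = refl
∑-+ (suc m) f g = begin
  ∑ m (λ i → f i + g i) + (f (suc m) + g (suc m)) ≡⟨ cong (_+ (f (suc m) + g (suc m))) (∑-+ m f g) ⟩
  (∑ m f + ∑ m g) + (f (suc m) + g (suc m))       ≡⟨ +-interchange (∑ m f) (∑ m g) _ _ ⟩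
  (∑ m f + f (suc m)) + (∑ m g + g (suc m))       ∎

∑-*ˡ : ∀ m k (f : ℕ → ℤ) → ∑ m (λ i → k * f i) ≡ k * ∑ m f
∑-*ˡ zero    k f = sym (ℤP.*-zeroʳ k)
∑-*ˡ (suc m) k f = trans (cong (_+ k * f (suc m)) (∑-*ˡ m k f)) (sym (ℤP.*-distribˡ-+ k (∑ m f) (f (suc m))))

∑-zero : ∀ m {f : ℕ → ℤ} → (∀ i → f (suc i) ≡ 0ℤ) → ∑ m f ≡ 0ℤ
∑-zero zero    eq = refl
∑-zero (suc m) eq = cong₂ _+_ (∑-zero m eq) (eq m)

∑-const : ∀ m k → ∑ m (λ _ → k) ≡ + m * k
∑-const zero    k = refl
∑-const (suc m) k = begin
  ∑ m (λ _ → k) + k ≡⟨ cong (_+ k) (∑-const m k) ⟩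
  + m * k + k       ≡⟨ solve 2 (λ m k → m :* k :+ k := (con 1ℤ :+ m) :* k) refl (+ m) k ⟩
  + suc m * k       ∎
  where open ℤ-Solver

∑-comm : ∀ m l (f : ℕ → ℕ → ℤ) → ∑ m (λ i → ∑ l (f i)) ≡ ∑ l (λ j → ∑ m (λ i → f i j))
∑-comm zero    l f = sym (∑-zero l (λ _ → refl))
∑-comm (suc m) l f = trans (cong (_+ ∑ l (f (suc m))) (∑-comm m l f)) (sym (∑-+ l (λ j → ∑ m (λ i → f i j)) (f (suc m))))

∑-extend : ∀ {k m} → k ≤ m → (f : ℕ → ℤ) → (∀ i → k < i → f i ≡ 0ℤ) → ∑ k f ≡ ∑ m f
∑-extend {k} {zero} z≤n f vanish = refl
∑-extend {k} {suc m} k≤m f vanish with ℕP.m≤n⇒m<n∨m≡n k≤m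
... | inj₂ refl      = refl
... | inj₁ (s≤s k≤m′) = begin
  ∑ k f             ≡⟨ ∑-extend k≤m′ f vanish ⟩
  ∑ m f             ≡⟨ ℤP.+-identityʳ (∑ m f) ⟨
  ∑ m f + 0ℤ        ≡⟨ cong (λ t → ∑ m f + t) (vanish (suc m) (s≤s k≤m′)) ⟨
  ∑ m f + f (suc m) ∎

∑-telescope : ∀ m (f P : ℕ → ℤ) → P 0 ≡ 0ℤ → (∀ i → P (suc i) ≡ P i + f (suc i)) → ∑ m f ≡ P m
∑-telescope zero    f P P0 step = sym P0
∑-telescope (suc m) f P P0 step = trans (cong (_+ f (suc m)) (∑-telescope m f P P0 step)) (sym (step m))

-- Induction on `m`: the new row `u = suc m` on the left supplies the last term of every inner sum
-- on the right, and the new inner sum for `w = suc m` is empty.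
∑-triangle : ∀ m (G : ℕ → ℕ → ℤ) →
  ∑ m (λ u → ∑ (pred u) (G u)) ≡ ∑ m (λ w → ∑ (m ∸ w) (λ c → G (w ℕ.+ c) w))
∑-triangle zero    G = refl
∑-triangle (suc m) G = begin
  ∑ m (λ u → ∑ (pred u) (G u)) + ∑ m (G (suc m))
    ≡⟨ cong (_+ ∑ m (G (suc m))) (∑-triangle m G) ⟩
  ∑ m (λ w → ∑ (m ∸ w) (λ c → G (w ℕ.+ c) w)) + ∑ m (G (suc m))
    ≡⟨ ∑-+ m (λ w → ∑ (m ∸ w) (λ c → G (w ℕ.+ c) w)) (G (suc m)) ⟨
  ∑ m (λ w → ∑ (m ∸ w) (λ c → G (w ℕ.+ c) w) + G (suc m) w)
    ≡⟨ ∑-cong-< m row ⟩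
  ∑ m (λ w → ∑ (suc m ∸ w) (λ c → G (w ℕ.+ c) w))
    ≡⟨ ℤP.+-identityʳ _ ⟨
  ∑ m (λ w → ∑ (suc m ∸ w) (λ c → G (w ℕ.+ c) w)) + 0ℤ
    ≡⟨ cong (λ k → ∑ m (λ w → ∑ (suc m ∸ w) (λ c → G (w ℕ.+ c) w)) + ∑ k (λ c → G (suc m ℕ.+ c) (suc m))) (ℕP.n∸n≡0 m) ⟨
  ∑ (suc m) (λ w → ∑ (suc m ∸ w) (λ c → G (w ℕ.+ c) w)) ∎
  where
  row : ∀ i → i < m →
    ∑ (m ∸ suc i) (λ c → G (suc i ℕ.+ c) (suc i)) + G (suc m) (suc i)
    ≡ ∑ (m ∸ i) (λ c → G (suc i ℕ.+ c) (suc i))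
  row i i<m rewrite sym (ℕP.suc-pred (m ∸ i) ⦃ ℕ.≢-nonZero (ℕP.m>n⇒m∸n≢0 i<m) ⦄)
                  | ℕP.pred[m∸n]≡m∸[1+n] m i =
    cong (λ t → ∑ (m ∸ suc i) (λ c → G (suc i ℕ.+ c) (suc i)) + G t (suc i))
      (sym (trans (ℕP.+-suc (suc i) (m ∸ suc i)) (cong suc (ℕP.m+[n∸m]≡n i<m))))

∑-square : ∀ m (H : ℕ → ℕ → ℤ) →
  ∑ m (λ a → ∑ m (H a))
  ≡ (∑ m (λ b → ∑ (pred b) (λ a → H a b)) + ∑ m (λ a → ∑ (pred a) (H a))) + ∑ m (λ a → H a a)
∑-square zero    H = refl
∑-square (suc m) H = begin
  ∑ m (λ a → ∑ m (H a) + H a (suc m)) + (∑ m (H (suc m)) + H (suc m) (suc m))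
    ≡⟨ cong (_+ (R + D)) (∑-+ m (λ a → ∑ m (H a)) (λ a → H a (suc m))) ⟩
  (∑ m (λ a → ∑ m (H a)) + C) + (R + D)
    ≡⟨ cong (λ t → (t + C) + (R + D)) (∑-square m H) ⟩
  (((P + Q) + E) + C) + (R + D)
    ≡⟨ solve 6 (λ p q e c r d → (((p :+ q) :+ e) :+ c) :+ (r :+ d) := ((p :+ c) :+ (q :+ r)) :+ (e :+ d)) refl P Q E C R D ⟩
  ((P + C) + (Q + R)) + (E + D) ∎
  where
  open ℤ-Solver
  P = ∑ m (λ b → ∑ (pred b) (λ a → H a b))
  Q = ∑ m (λ a → ∑ (pred a) (H a))
  E = ∑ m (λ a → H a a)
  C = ∑ m (λ a → H a (suc m))
  R = ∑ m (H (suc m))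
  D = H (suc m) (suc m)

∑² : ℕ → (ℕ → ℕ → ℤ) → ℤ
∑² n G = ∑ n λ i → ∑ n λ j → G i j

∑³ : ℕ → (ℕ → ℕ → ℕ → ℤ) → ℤ
∑³ n G = ∑ n λ i → ∑ n λ j → ∑ n λ k → G i j k

∑²-cong : ∀ n {F G : ℕ → ℕ → ℤ} → (∀ i j → F (suc i) (suc j) ≡ G (suc i) (suc j)) → ∑² n F ≡ ∑² n G
∑²-cong n eq = ∑-cong n λ i → ∑-cong n λ j → eq i j

∑³-cong : ∀ n {F G : ℕ → ℕ → ℕ → ℤ} →
  (∀ i j k → F (suc i) (suc j) (suc k) ≡ G (suc i) (suc j) (suc k)) → ∑³ n F ≡ ∑³ n G
∑³-cong n eq = ∑-cong n λ i → ∑²-cong n (eq i)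

∑²-+ : ∀ n (F G : ℕ → ℕ → ℤ) → ∑² n (λ i j → F i j + G i j) ≡ ∑² n F + ∑² n G
∑²-+ n F G = trans (∑-cong n λ i → ∑-+ n (F (suc i)) (G (suc i))) (∑-+ n _ _)

∑³-+ : ∀ n (F G : ℕ → ℕ → ℕ → ℤ) → ∑³ n (λ i j k → F i j k + G i j k) ≡ ∑³ n F + ∑³ n G
∑³-+ n F G = trans (∑-cong n λ i → ∑²-+ n (F (suc i)) (G (suc i))) (∑-+ n _ _)

∑²-*ˡ : ∀ n k (F : ℕ → ℕ → ℤ) → ∑² n (λ i j → k * F i j) ≡ k * ∑² n F
∑²-*ˡ n k F = trans (∑-cong n λ i → ∑-*ˡ n k (F (suc i))) (∑-*ˡ n k _)

∑³-*ˡ : ∀ n k (F : ℕ → ℕ → ℕ → ℤ) → ∑³ n (λ i j l → k * F i j l) ≡ k * ∑³ n F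
∑³-*ˡ n k F = trans (∑-cong n λ i → ∑²-*ˡ n k (F (suc i))) (∑-*ˡ n k _)

∑²-zero : ∀ n {F : ℕ → ℕ → ℤ} → (∀ i j → F (suc i) (suc j) ≡ 0ℤ) → ∑² n F ≡ 0ℤ
∑²-zero n eq = ∑-zero n λ i → ∑-zero n (eq i)

∑³-zero : ∀ n {F : ℕ → ℕ → ℕ → ℤ} → (∀ i j k → F (suc i) (suc j) (suc k) ≡ 0ℤ) → ∑³ n F ≡ 0ℤ
∑³-zero n eq = ∑-zero n λ i → ∑²-zero n (eq i)

∑²-comm : ∀ n (F : ℕ → ℕ → ℤ) → ∑² n F ≡ ∑² n (λ j i → F i j)
∑²-comm n F = ∑-comm n n F

∑³-comm₁₂ : ∀ n (F : ℕ → ℕ → ℕ → ℤ) → ∑³ n F ≡ ∑³ n (λ j i k → F i j k)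
∑³-comm₁₂ n F = ∑-comm n n λ i j → ∑ n (F i j)

∑³-comm₂₃ : ∀ n (F : ℕ → ℕ → ℕ → ℤ) → ∑³ n F ≡ ∑³ n (λ i k j → F i j k)
∑³-comm₂₃ n F = ∑-cong n λ i → ∑²-comm n (F (suc i))

∑-∑²-comm : ∀ n m (F : ℕ → ℕ → ℕ → ℤ) → ∑ m (λ i → ∑² n (F i)) ≡ ∑² n (λ j k → ∑ m λ i → F i j k)
∑-∑²-comm n m F = trans (∑-comm m n _) (∑-cong n λ j → ∑-comm m n _)

∑-∑³-comm : ∀ n m (F : ℕ → ℕ → ℕ → ℕ → ℤ) →
  ∑ m (λ i → ∑³ n (F i)) ≡ ∑³ n (λ j k l → ∑ m λ i → F i j k l)
∑-∑³-comm n m F = trans (∑-comm m n _) (∑-cong n λ j → ∑-∑²-comm n m _)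

∑²-∑²-comm : ∀ n (F : ℕ → ℕ → ℕ → ℕ → ℤ) →
  ∑² n (λ a b → ∑² n λ x y → F a b x y) ≡ ∑² n (λ x y → ∑² n λ a b → F a b x y)
∑²-∑²-comm n F = trans (∑-cong n λ a → ∑-∑²-comm n n _) (∑-∑²-comm n n _)

∑³-∑³-comm : ∀ n (F : ℕ → ℕ → ℕ → ℕ → ℕ → ℕ → ℤ) →
  ∑³ n (λ a b c → ∑³ n λ x y z → F a b c x y z) ≡ ∑³ n (λ x y z → ∑³ n λ a b c → F a b c x y z)
∑³-∑³-comm n F =
  trans (∑-cong n λ a → trans (∑-cong n λ b → ∑-∑³-comm n n _) (∑-∑³-comm n n _)) (∑-∑³-comm n n _)

-- Since `G` vanishes once its first argument exceeds `n`, the gap `c` may run up to `n` whatever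
-- `w` is. This rectangular range is what allows sums over parts and multiplicities to be
-- interchanged.
∑-nested : ∀ n (G : ℕ → ℕ → ℤ) → (∀ u w → n < u → G u w ≡ 0ℤ) →
  ∑ n (λ u → ∑ (pred u) (G u)) ≡ ∑² n (λ w c → G (w ℕ.+ c) w)
∑-nested n G vanish = trans (∑-triangle n G) (∑-cong n λ i →
  ∑-extend (ℕP.m∸n≤m n (suc i)) (λ c → G (suc i ℕ.+ c) (suc i))
    λ c lt → vanish (suc i ℕ.+ c) (suc i) (ℕP.≤-<-trans (ℕP.m≤n+m∸n n (suc i)) (ℕP.+-monoʳ-< (suc i) lt)))

-- Trichotomy of `a < b`, `a > b` and `a = b`, with the gap as the new variable: the quasi-shuffle
-- of two parts.
∑-stuffle : ∀ n (H : ℕ → ℕ → ℤ) → (∀ a b → n < a → H a b ≡ 0ℤ) → (∀ a b → n < b → H a b ≡ 0ℤ) →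
  ∑² n H ≡ (∑² n (λ a b → H a (a ℕ.+ b)) + ∑² n (λ b a → H (b ℕ.+ a) b)) + ∑ n (λ a → H a a)
∑-stuffle n H vanish₁ vanish₂ = trans (∑-square n H) (cong (_+ ∑ n (λ a → H a a))
  (cong₂ _+_ (∑-nested n (λ b a → H a b) (λ b a → vanish₂ a b)) (∑-nested n H vanish₁)))

-- Weighted partition sums, conjugation and the splitting of products

module Splitting (n : ℕ) (K : ℕ → ℤ) (K-vanish : ∀ {q} → n < q → K q ≡ 0ℤ) where

  Weight₁ Weight₂ Weight₃ : Set
  Weight₁ = ℕ → ℕ → ℤ
  Weight₂ = ℕ → ℕ → ℕ → ℕ → ℤ
  Weight₃ = ℕ → ℕ → ℕ → ℕ → ℕ → ℕ → ℤ

  -- T₁, T₂, T₃ sum a weight over u₁ > ⋯ > u_l > 0 and v₁ , … , v_l > 0 subject to K (∑ uᵢ vᵢ); the uᵢ are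
  -- given by their gaps (u₃ , u₂ , u₁) = (a , a + b , a + b + c), and (x , y , z) = (v₁ , v₂ , v₃).
  T₁ : Weight₁ → ℤ
  T₁ W = ∑² n λ a x → K (a ℕ.* x) * W a x

  T₂ : Weight₂ → ℤ
  T₂ W = ∑² n λ a b → ∑² n λ x y → K (a ℕ.* (x ℕ.+ y) ℕ.+ b ℕ.* x) * W a b x y

  T₃ : Weight₃ → ℤ
  T₃ W = ∑³ n λ a b c → ∑³ n λ x y z →
    K (a ℕ.* (x ℕ.+ y ℕ.+ z) ℕ.+ b ℕ.* (x ℕ.+ y) ℕ.+ c ℕ.* x) * W a b c x y z

  -- The same sums for a product of two brackets, of lengths 1 and 1 (P₁₁) or 1 and 2 (P₁₂).
  P₁₁ : Weight₂ → ℤ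
  P₁₁ W = ∑² n λ a b → ∑² n λ x y → K (a ℕ.* x ℕ.+ b ℕ.* y) * W a b x y

  P₁₂ : Weight₃ → ℤ
  P₁₂ W = ∑³ n λ a b c → ∑³ n λ x y z → K (a ℕ.* x ℕ.+ b ℕ.* (y ℕ.+ z) ℕ.+ c ℕ.* y) * W a b c x y z

  -- Conjugation of partitions: all the forms are invariant under exchanging gaps and multiplicities.
  dual₁ : Weight₁ → Weight₁
  dual₁ W a x = W x a

  dual₂ : Weight₂ → Weight₂
  dual₂ W a b x y = W x y a b

  dual₃ : Weight₃ → Weight₃
  dual₃ W a b c x y z = W x y z a b c

  K-cong : ∀ {p q} → p ≡ q → ∀ w → K p * w ≡ K q * w
  K-cong eq w = cong (λ t → K t * w) eq

  K-vanish-* : ∀ {q} → n < q → ∀ w → K q * w ≡ 0ℤ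
  K-vanish-* lt w = trans (cong (_* w) (K-vanish lt)) (ℤP.*-zeroˡ w)

  T₁-dual : ∀ W → T₁ W ≡ T₁ (dual₁ W)
  T₁-dual W = trans (∑²-comm n _) (∑²-cong n λ i j → K-cong (ℕP.*-comm (suc j) (suc i)) _)

  T₂-dual : ∀ W → T₂ W ≡ T₂ (dual₂ W)
  T₂-dual W = trans (∑²-∑²-comm n _) (∑²-cong n λ x y → ∑²-cong n λ a b → K-cong (form (suc a) (suc b) (suc x) (suc y)) _)
    where
    open ℕ-Solver
    form = solve 4 (λ a b x y → a :* (x :+ y) :+ b :* x := x :* (a :+ b) :+ y :* a) refl

  T₃-dual : ∀ W → T₃ W ≡ T₃ (dual₃ W)
  T₃-dual W = trans (∑³-∑³-comm n _) (∑³-cong n λ x y z → ∑³-cong n λ a b c →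
      K-cong (form (suc a) (suc b) (suc c) (suc x) (suc y) (suc z)) _)
    where
    open ℕ-Solver
    form = solve 6 (λ a b c x y z → a :* (x :+ y :+ z) :+ b :* (x :+ y) :+ c :* x
                                 := x :* (a :+ b :+ c) :+ y :* (a :+ b) :+ z :* a) refl

  P₁₁-dual : ∀ W → P₁₁ W ≡ P₁₁ (dual₂ W)
  P₁₁-dual W = trans (∑²-∑²-comm n _) (∑²-cong n λ x y → ∑²-cong n λ a b → K-cong (form (suc a) (suc b) (suc x) (suc y)) _)
    where
    open ℕ-Solver
    form = solve 4 (λ a b x y → a :* x :+ b :* y := x :* a :+ y :* b) refl

  P₁₂-dual : ∀ W → P₁₂ W ≡ P₁₂ (dual₃ W)
  P₁₂-dual W = trans (∑³-∑³-comm n _) (∑³-cong n λ x y z → ∑³-cong n λ a b c →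
      K-cong (form (suc a) (suc b) (suc c) (suc x) (suc y) (suc z)) _)
    where
    open ℕ-Solver
    form = solve 6 (λ a b c x y z → a :* x :+ b :* (y :+ z) :+ c :* y
                                 := x :* a :+ y :* (b :+ c) :+ z :* b) refl

  K-distrib : ∀ q u v → K q * (u + v) ≡ K q * u + K q * v
  K-distrib q = ℤP.*-distribˡ-+ (K q)

  T₁-cong : ∀ {V W : Weight₁} → (∀ a x → V (suc a) (suc x) ≡ W (suc a) (suc x)) → T₁ V ≡ T₁ W
  T₁-cong eq = ∑²-cong n λ a x → cong (K _ *_) (eq a x)

  T₂-cong : ∀ {V W : Weight₂} →
    (∀ a b x y → V (suc a) (suc b) (suc x) (suc y) ≡ W (suc a) (suc b) (suc x) (suc y)) → T₂ V ≡ T₂ W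
  T₂-cong eq = ∑²-cong n λ a b → ∑²-cong n λ x y → cong (K _ *_) (eq a b x y)

  T₃-cong : ∀ {V W : Weight₃} →
    (∀ a b c x y z → V (suc a) (suc b) (suc c) (suc x) (suc y) (suc z)
                   ≡ W (suc a) (suc b) (suc c) (suc x) (suc y) (suc z)) → T₃ V ≡ T₃ W
  T₃-cong eq = ∑³-cong n λ a b c → ∑³-cong n λ x y z → cong (K _ *_) (eq a b c x y z)

  T₁-+ : ∀ V W → T₁ (λ a x → V a x + W a x) ≡ T₁ V + T₁ W
  T₁-+ V W = trans (∑²-cong n λ a x → K-distrib _ _ _) (∑²-+ n _ _)

  T₂-+ : ∀ V W → T₂ (λ a b x y → V a b x y + W a b x y) ≡ T₂ V + T₂ W
  T₂-+ V W = trans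
    (∑²-cong n λ a b → trans (∑²-cong n λ x y → K-distrib _ _ _) (∑²-+ n _ _)) (∑²-+ n _ _)

  T₃-+ : ∀ V W → T₃ (λ a b c x y z → V a b c x y z + W a b c x y z) ≡ T₃ V + T₃ W
  T₃-+ V W = trans
    (∑³-cong n λ a b c → trans (∑³-cong n λ x y z → K-distrib _ _ _) (∑³-+ n _ _)) (∑³-+ n _ _)

  K-scale : ∀ q k w → K q * (k * w) ≡ k * (K q * w)
  K-scale q k w = solve 3 (λ q k w → q :* (k :* w) := k :* (q :* w)) refl (K q) k w
    where open ℤ-Solver

  T₁-*ˡ : ∀ k W → T₁ (λ a x → k * W a x) ≡ k * T₁ W
  T₁-*ˡ k W = trans (∑²-cong n λ a x → K-scale _ k _) (∑²-*ˡ n k _)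

  T₂-*ˡ : ∀ k W → T₂ (λ a b x y → k * W a b x y) ≡ k * T₂ W
  T₂-*ˡ k W = trans
    (∑²-cong n λ a b → trans (∑²-cong n λ x y → K-scale _ k _) (∑²-*ˡ n k _)) (∑²-*ˡ n k _)

  T₃-*ˡ : ∀ k W → T₃ (λ a b c x y z → k * W a b c x y z) ≡ k * T₃ W
  T₃-*ˡ k W = trans
    (∑³-cong n λ a b c → trans (∑³-cong n λ x y z → K-scale _ k _) (∑³-*ˡ n k _)) (∑³-*ˡ n k _)

  -- Used when parts of the two factors coincide: the form then sees their multiplicities only
  -- through the sum `u = x + z`, and collecting equal `u` leaves a convolution of the weight.
  merge : ∀ (k : ℕ → ℤ) → (∀ u → n < u → k u ≡ 0ℤ) → ∀ (g : ℕ → ℕ → ℤ) →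
    ∑² n (λ x z → k (x ℕ.+ z) * g x z) ≡ ∑ n (λ u → k u * ∑ (pred u) (λ x → g x (u ∸ x)))
  merge k vanish g = begin
    ∑² n (λ x z → k (x ℕ.+ z) * g x z)
      ≡⟨ ∑²-cong n (λ x z → cong (λ t → k (suc x ℕ.+ suc z) * g (suc x) t) (ℕP.m+n∸m≡n (suc x) (suc z))) ⟨
    ∑² n (λ x z → G (x ℕ.+ z) x)
      ≡⟨ ∑-nested n G (λ u w lt → trans (cong (_* g w (u ∸ w)) (vanish u lt)) (ℤP.*-zeroˡ (g w (u ∸ w)))) ⟨
    ∑ n (λ u → ∑ (pred u) (G u))
      ≡⟨ ∑-cong n (λ u → ∑-*ˡ u (k (suc u)) (λ x → g x (suc u ∸ x))) ⟩
    ∑ n (λ u → k u * ∑ (pred u) (λ x → g x (u ∸ x))) ∎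
    where
    G : ℕ → ℕ → ℤ
    G u x = k u * g x (u ∸ x)

  -- The parts of the two factors satisfy `a < b`, `a > b` or `a = b`. In `T₂` the variable `x`
  -- belongs to the larger part, whence the exchange of `x` and `y` in the first weight.
  P₁₁-split : ∀ W → P₁₁ W ≡
    T₂ (λ a b x y → W a (a ℕ.+ b) y x + W (a ℕ.+ b) a x y)
    + T₁ (λ a x → ∑ (pred x) λ i → W a a i (x ∸ i))
  P₁₁-split W = trans (∑-stuffle n H vanish₁ vanish₂)
    (cong₂ _+_ (trans (cong₂ _+_ left right) (sym (T₂-+ V₁ V₂))) middle)
    where
    open ℕ-Solver
    H : ℕ → ℕ → ℤ
    H a b = ∑² n λ x y → K (a ℕ.* x ℕ.+ b ℕ.* y) * W a b x y
    V₁ V₂ : Weight₂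
    V₁ a b x y = W a (a ℕ.+ b) y x
    V₂ a b x y = W (a ℕ.+ b) a x y
    vanish₁ : ∀ a b → n < a → H a b ≡ 0ℤ
    vanish₁ a b lt = ∑²-zero n λ x y → K-vanish-*
      (ℕP.<-≤-trans lt (ℕP.≤-trans (ℕP.m≤m*n a (suc x)) (ℕP.m≤m+n _ (b ℕ.* suc y)))) _
    vanish₂ : ∀ a b → n < b → H a b ≡ 0ℤ
    vanish₂ a b lt = ∑²-zero n λ x y → K-vanish-*
      (ℕP.<-≤-trans lt (ℕP.≤-trans (ℕP.m≤m*n b (suc y)) (ℕP.m≤n+m _ (a ℕ.* suc x)))) _
    left : ∑² n (λ a b → H a (a ℕ.+ b)) ≡ T₂ V₁
    left = ∑²-cong n λ a b → trans (∑²-comm n _) (∑²-cong n λ x y →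
      K-cong (solve 4 (λ a b x y → a :* y :+ (a :+ b) :* x := a :* (x :+ y) :+ b :* x) refl
        (suc a) (suc b) (suc x) (suc y)) _)
    right : ∑² n (λ a b → H (a ℕ.+ b) a) ≡ T₂ V₂
    right = ∑²-cong n λ a b → ∑²-cong n λ x y →
      K-cong (solve 4 (λ a b x y → (a :+ b) :* x :+ a :* y := a :* (x :+ y) :+ b :* x) refl
        (suc a) (suc b) (suc x) (suc y)) _
    middle : ∑ n (λ a → H a a) ≡ T₁ (λ a x → ∑ (pred x) λ i → W a a i (x ∸ i))
    middle = ∑-cong n λ a → trans
      (∑²-cong n λ x y → K-cong (sym (ℕP.*-distribˡ-+ (suc a) (suc x) (suc y))) _)
      (merge (λ u → K (suc a ℕ.* u)) (λ u lt → K-vanish (ℕP.<-≤-trans lt (ℕP.m≤n*m u (suc a)))) (W (suc a) (suc a)))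

  -- The part of the first factor is inserted among the two parts of the second. Lowest, middle and
  -- highest position give the three weights of `T₃`; coincidence with the larger or the smaller
  -- part gives the two sums in `T₂`.
  P₁₂-split : ∀ W → P₁₂ W ≡
    T₃ (λ a b c x y z → W a (a ℕ.+ b) c z x y
      + (W (a ℕ.+ b) a (b ℕ.+ c) y x z + W (a ℕ.+ (b ℕ.+ c)) a b x y z))
    + T₂ (λ a b x y → ∑ (pred x) (λ i → W (a ℕ.+ b) a b i (x ∸ i) y)
      + ∑ (pred y) (λ i → W a a b i x (y ∸ i)))
  P₁₂-split W = begin
    P₁₂ W
      ≡⟨ ∑-stuffle n H vanish₁ vanish₂ ⟩
    (∑² n (λ a b → H a (a ℕ.+ b)) + ∑² n (λ b a → H (b ℕ.+ a) b)) + ∑ n (λ a → H a a)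
      ≡⟨ cong₂ _+_ (cong₂ _+_ first later) equal ⟩
    (T₃ V₁ + ((T₃ V₂ + T₃ V₃) + T₂ U₁)) + T₂ U₂
      ≡⟨ regroup (T₃ V₁) (T₃ V₂) (T₃ V₃) (T₂ U₁) (T₂ U₂) ⟩
    (T₃ V₁ + (T₃ V₂ + T₃ V₃)) + (T₂ U₁ + T₂ U₂)
      ≡⟨ cong₂ _+_ (trans (T₃-+ V₁ _) (cong (λ t → T₃ V₁ + t) (T₃-+ V₂ V₃))) (T₂-+ U₁ U₂) ⟨
    _ ∎
    where
    open ℕ-Solver
    regroup : ∀ p q r s t → (p + ((q + r) + s)) + t ≡ (p + (q + r)) + (s + t)
    regroup = ℤS.solve 5 (λ p q r s t →
      (p ℤS.:+ ((q ℤS.:+ r) ℤS.:+ s)) ℤS.:+ t ℤS.:= (p ℤS.:+ (q ℤS.:+ r)) ℤS.:+ (s ℤS.:+ t)) refl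
      where module ℤS = ℤ-Solver
    V₁ V₂ V₃ : Weight₃
    V₁ a b c x y z = W a (a ℕ.+ b) c z x y
    V₂ a b c x y z = W (a ℕ.+ b) a (b ℕ.+ c) y x z
    V₃ a b c x y z = W (a ℕ.+ (b ℕ.+ c)) a b x y z
    U₁ U₂ : Weight₂
    U₁ a b x y = ∑ (pred x) λ i → W (a ℕ.+ b) a b i (x ∸ i) y
    U₂ a b x y = ∑ (pred y) λ i → W a a b i x (y ∸ i)
    H : ℕ → ℕ → ℤ
    H a b = ∑ n λ c → ∑³ n λ x y z → K (a ℕ.* x ℕ.+ b ℕ.* (y ℕ.+ z) ℕ.+ c ℕ.* y) * W a b c x y z
    vanish₁ : ∀ a b → n < a → H a b ≡ 0ℤ
    vanish₁ a b lt = ∑-zero n λ c → ∑³-zero n λ x y z → K-vanish-*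
      (ℕP.<-≤-trans lt (ℕP.≤-trans (ℕP.≤-trans (ℕP.m≤m*n a (suc x)) (ℕP.m≤m+n _ _)) (ℕP.m≤m+n _ _))) _
    vanish₂ : ∀ a b → n < b → H a b ≡ 0ℤ
    vanish₂ a b lt = ∑-zero n λ c → ∑³-zero n λ x y z → K-vanish-*
      (ℕP.<-≤-trans lt (ℕP.≤-trans (ℕP.≤-trans (ℕP.m≤m*n b (suc y ℕ.+ suc z))
        (ℕP.m≤n+m _ (a ℕ.* suc x))) (ℕP.m≤m+n _ _))) _
    -- If the part of the first factor exceeds the smaller part `b`, its excess `a` is compared with
    -- the gap `c` by a second use of `∑-stuffle`.
    H′ : ℕ → ℕ → ℕ → ℤ
    H′ b a c = ∑³ n λ x y z → K ((b ℕ.+ a) ℕ.* x ℕ.+ b ℕ.* (y ℕ.+ z) ℕ.+ c ℕ.* y) * W (b ℕ.+ a) b c x y z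
    vanish′₁ : ∀ b a c → n < a → H′ b a c ≡ 0ℤ
    vanish′₁ b a c lt = ∑³-zero n λ x y z → K-vanish-*
      (ℕP.<-≤-trans lt (ℕP.≤-trans (ℕP.≤-trans (ℕP.≤-trans (ℕP.m≤n+m a b) (ℕP.m≤m*n (b ℕ.+ a) (suc x)))
        (ℕP.m≤m+n _ _)) (ℕP.m≤m+n _ _))) _
    vanish′₂ : ∀ b a c → n < c → H′ b a c ≡ 0ℤ
    vanish′₂ b a c lt = ∑³-zero n λ x y z → K-vanish-*
      (ℕP.<-≤-trans lt (ℕP.≤-trans (ℕP.m≤m*n c (suc y)) (ℕP.m≤n+m _ _))) _
    first : ∑² n (λ a b → H a (a ℕ.+ b)) ≡ T₃ V₁
    first = ∑³-cong n λ a b c → trans (trans (∑³-comm₁₂ n _) (∑³-comm₂₃ n _)) (∑³-cong n λ x y z →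
      K-cong (solve 6 (λ a b c x y z → a :* z :+ (a :+ b) :* (x :+ y) :+ c :* x
          := a :* (x :+ y :+ z) :+ b :* (x :+ y) :+ c :* x) refl
        (suc a) (suc b) (suc c) (suc x) (suc y) (suc z)) _)
    second : ∑³ n (λ b a c → H′ b a (a ℕ.+ c)) ≡ T₃ V₂
    second = ∑³-cong n λ a b c → trans (∑³-comm₁₂ n _) (∑³-cong n λ x y z →
      K-cong (solve 6 (λ a b c x y z → (a :+ b) :* y :+ a :* (x :+ z) :+ (b :+ c) :* x
          := a :* (x :+ y :+ z) :+ b :* (x :+ y) :+ c :* x) refl
        (suc a) (suc b) (suc c) (suc x) (suc y) (suc z)) _)
    third : ∑³ n (λ b c a → H′ b (c ℕ.+ a) c) ≡ T₃ V₃
    third = ∑³-cong n λ a b c → ∑³-cong n λ x y z →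
      K-cong (solve 6 (λ a b c x y z → (a :+ (b :+ c)) :* x :+ a :* (y :+ z) :+ b :* y
          := a :* (x :+ y :+ z) :+ b :* (x :+ y) :+ c :* x) refl
        (suc a) (suc b) (suc c) (suc x) (suc y) (suc z)) _
    fourth : ∑² n (λ b a → H′ b a a) ≡ T₂ U₁
    fourth = ∑²-cong n λ a b → begin
      H′ (suc a) (suc b) (suc b)
        ≡⟨ trans (∑³-comm₂₃ n _) (∑³-comm₁₂ n _) ⟩
      _ ≡⟨ ∑³-cong n {G = λ y i j → K (suc a ℕ.* ((i ℕ.+ j) ℕ.+ y) ℕ.+ suc b ℕ.* (i ℕ.+ j))
                                     * W (suc a ℕ.+ suc b) (suc a) (suc b) i j y} (λ y i j →
             K-cong (solve 5 (λ a b i j y → (a :+ b) :* i :+ a :* (j :+ y) :+ b :* j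
                 := a :* ((i :+ j) :+ y) :+ b :* (i :+ j)) refl
               (suc a) (suc b) (suc i) (suc j) (suc y)) _) ⟩
      _ ≡⟨ ∑-cong n (λ y → merge (λ u → K (suc a ℕ.* (u ℕ.+ suc y) ℕ.+ suc b ℕ.* u))
             (λ u lt → K-vanish (ℕP.<-≤-trans lt
               (ℕP.≤-trans (ℕP.m≤n*m u (suc b)) (ℕP.m≤n+m _ (suc a ℕ.* (u ℕ.+ suc y))))))
             (λ i j → W (suc a ℕ.+ suc b) (suc a) (suc b) i j (suc y))) ⟩
      _ ≡⟨ ∑²-comm n _ ⟩
      _ ∎
    later : ∑² n (λ b a → H (b ℕ.+ a) b) ≡ (T₃ V₂ + T₃ V₃) + T₂ U₁
    later = begin
      ∑² n (λ b a → H (b ℕ.+ a) b)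
        ≡⟨ ∑-cong n (λ b → ∑-stuffle n (H′ (suc b)) (vanish′₁ (suc b)) (vanish′₂ (suc b))) ⟩
      _ ≡⟨ trans (∑-+ n _ _) (cong (λ t → t + ∑² n (λ b a → H′ b a a)) (∑-+ n _ _)) ⟩
      _ ≡⟨ cong₂ _+_ (cong₂ _+_ second third) fourth ⟩
      _ ∎
    equal : ∑ n (λ a → H a a) ≡ T₂ U₂
    equal = ∑²-cong n λ a b → begin
      _ ≡⟨ ∑³-comm₁₂ n _ ⟩
      _ ≡⟨ ∑³-cong n {G = λ x i j → K (suc a ℕ.* (x ℕ.+ (i ℕ.+ j)) ℕ.+ suc b ℕ.* x)
                                     * W (suc a) (suc a) (suc b) i x j} (λ x i j →
             K-cong (solve 5 (λ a b x i j → a :* i :+ a :* (x :+ j) :+ b :* x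
                 := a :* (x :+ (i :+ j)) :+ b :* x) refl
               (suc a) (suc b) (suc x) (suc i) (suc j)) _) ⟩
      _ ≡⟨ ∑-cong n (λ x → merge (λ u → K (suc a ℕ.* (suc x ℕ.+ u) ℕ.+ suc b ℕ.* suc x))
             (λ u lt → K-vanish (ℕP.<-≤-trans lt (ℕP.≤-trans (ℕP.≤-trans (ℕP.m≤n+m u (suc x)) (ℕP.m≤n*m _ (suc a))) (ℕP.m≤m+n _ _))))
             (λ i j → W (suc a) (suc a) (suc b) i (suc x) j)) ⟩
      _ ∎

-- Polynomial weights and certificates

Poly : ℕ → Set
Poly l = List (ℤ × Vec ℕ l)

monomial : ∀ {l} → Vec ℕ l → Vec ℤ l → ℤ
monomial []       []       = 1ℤ
monomial (e ∷ es) (x ∷ xs) = x ^ e * monomial es xs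

value : ∀ {l} → Poly l → Vec ℤ l → ℤ
value []            xs = 0ℤ
value ((m , e) ∷ p) xs = m * monomial e xs + value p xs

value₃ : Poly 3 → ℤ → ℤ → ℤ → ℤ
value₃ p x y z = value p (x ∷ y ∷ z ∷ [])

value₂ : Poly 2 → ℤ → ℤ → ℤ
value₂ p x y = value p (x ∷ y ∷ [])

value₁ : Poly 1 → ℤ → ℤ
value₁ p x = value p (x ∷ [])

-- Discrete primitives put the convolutions of `merge` into closed form. The laws range over all
-- integers, which makes them polynomial identities that normalisation can check.
record IsAntidifference (A : Poly 3) (g : ℤ → ℤ → ℤ → ℤ) : Set where
  field
    zero-law : ∀ x y → value₃ A 0ℤ x y ≡ 0ℤ
    suc-law  : ∀ i x y → value₃ A (1ℤ + i) x y ≡ value₃ A i x y + g (1ℤ + i) x y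

  ∑-value : ∀ m x y → ∑ m (λ i → g (+ i) x y) ≡ value₃ A (+ m) x y
  ∑-value m x y = ∑-telescope m _ (λ i → value₃ A (+ i) x y) (zero-law x y) (λ i → suc-law (+ i) x y)

-- For `0 < i < suc x` truncated subtraction agrees with integer subtraction, so the summand may be
-- replaced by the polynomial `g`.
∑-below : ∀ {A g} → IsAntidifference A g → ∀ x u v (W : ℕ → ℕ → ℤ) →
  (∀ i j → + j ≡ + suc x - + i → W i j ≡ g (+ i) u v) →
  ∑ x (λ i → W i (suc x ∸ i)) ≡ value₃ A (+ x) u v
∑-below {g = g} anti x u v W eq = trans (∑-cong-< x step) (IsAntidifference.∑-value anti x u v)
  where
  step : ∀ i → i < x → W (suc i) (x ∸ i) ≡ g (+ suc i) u v
  step i i<x = eq (suc i) (x ∸ i) (sym (trans (ℤP.m-n≡m⊖n (suc x) (suc i)) (ℤP.⊖-≥ (s≤s (ℕP.<⇒≤ i<x)))))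

-- f (x , y , z) is the weight put on P₁₂ and h (b , x , y) the one put on P₁₁. Each law compares the weights
-- obtained by splitting along u (left) and along v (right); the difference must not involve a and b.
record Certificate : Set where
  field
    f h         : Poly 3
    A₁ A₂ B₁ B₂ : Poly 3
    L₃          : Poly 3
    L₂          : Poly 2
    L₁          : Poly 1

    A₁-law : IsAntidifference A₁ (λ i x y → value₃ f i (x - i) y)
    A₂-law : IsAntidifference A₂ (λ i x y → value₃ f i x (y - i))
    B₁-law : IsAntidifference B₁ (λ i b x → value₃ h b i (x - i))
    B₂-law : IsAntidifference B₂ (λ i x b → value₃ h (b - i) x x)

    L₃-law : ∀ x y z →
      value₃ f z x y + (value₃ f y x z + value₃ f x y z)
      ≡ (value₃ f x (x + y) z + (value₃ f (x + y) x (y + z) + value₃ f (x + (y + z)) x y)) + value₃ L₃ x y z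
    L₂-law : ∀ a b x y →
      (value₃ A₁ (x - 1ℤ) x y + value₃ A₂ (y - 1ℤ) x y) + (value₃ h (a + b) y x + value₃ h a x y)
      ≡ (((a - 1ℤ) * value₃ f (x + y) x y + (b - 1ℤ) * value₃ f x x y)
         + (value₃ h a x (x + y) + value₃ h b (x + y) x)) + value₂ L₂ x y
    L₁-law : ∀ a x → value₃ B₁ (x - 1ℤ) a x ≡ value₃ B₂ (a - 1ℤ) x a + value₁ L₁ x

private
  -- The `x` terms come from the direct splittings and the `y` terms from the conjugated ones. The
  -- middle hypothesis concerns the sum `x₂ + x₂′` because the terms of length 2 that are not
  -- brackets cancel only between the two products.
  cancel : ∀ {x₁ x₂ x₂′ x₃ y₁ y₂ y₂′ y₃ l₁ l₂ l₃} →
    x₃ ≡ y₃ + l₃ → x₂ + x₂′ ≡ (y₂ + y₂′) + l₂ → x₁ ≡ y₁ + l₁ →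
    x₃ + x₂ ≡ y₃ + y₂ → x₂′ + x₁ ≡ y₂′ + y₁ → l₃ + (l₂ + l₁) ≡ 0ℤ
  cancel {x₁} {x₂} {x₂′} {x₃} {y₁} {y₂} {y₂′} {y₃} {l₁} {l₂} {l₃} e₃ e₂ e₁ p q =
    cancelˡ ℤP.+-0-abelianGroup ((y₃ + y₂) + (y₂′ + y₁)) _ _ (begin
      ((y₃ + y₂) + (y₂′ + y₁)) + (l₃ + (l₂ + l₁))
        ≡⟨ solve 7 (λ y₁ y₂ y₂′ y₃ l₁ l₂ l₃ → ((y₃ :+ y₂) :+ (y₂′ :+ y₁)) :+ (l₃ :+ (l₂ :+ l₁))
             := (y₃ :+ l₃) :+ (((y₂ :+ y₂′) :+ l₂) :+ (y₁ :+ l₁))) refl y₁ y₂ y₂′ y₃ l₁ l₂ l₃ ⟩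
      (y₃ + l₃) + (((y₂ + y₂′) + l₂) + (y₁ + l₁))
        ≡⟨ cong₂ _+_ e₃ (cong₂ _+_ e₂ e₁) ⟨
      x₃ + ((x₂ + x₂′) + x₁)
        ≡⟨ solve 4 (λ x₁ x₂ x₂′ x₃ → x₃ :+ ((x₂ :+ x₂′) :+ x₁) := (x₃ :+ x₂) :+ (x₂′ :+ x₁)) refl x₁ x₂ x₂′ x₃ ⟩
      (x₃ + x₂) + (x₂′ + x₁)
        ≡⟨ cong₂ _+_ p q ⟩
      (y₃ + y₂) + (y₂′ + y₁)
        ≡⟨ ℤP.+-identityʳ _ ⟨
      ((y₃ + y₂) + (y₂′ + y₁)) + 0ℤ ∎)
    where open ℤ-Solver

module _ (C : Certificate) (n : ℕ) (K : ℕ → ℤ) (K-vanish : ∀ {q} → n < q → K q ≡ 0ℤ) where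
  open Certificate C
  open Splitting n K K-vanish

  -- Each product is split directly and after conjugation; the second result is conjugated back term
  -- by term, so that both expansions are sums over the same variables and the laws compare them
  -- pointwise.
  certified :
    T₃ (λ _ _ _ x y z → value₃ L₃ (+ x) (+ y) (+ z))
    + (T₂ (λ _ _ x y → value₂ L₂ (+ x) (+ y)) + T₁ (λ _ x → value₁ L₁ (+ x))) ≡ 0ℤ
  certified = cancel {x₁ = T₁ X₁} {T₂ X₂} {T₂ X₂′} {T₃ X₃} {T₁ Y₁} {T₂ Y₂} {T₂ Y₂′} {T₃ Y₃}
    (trans (T₃-cong λ a b c x y z → L₃-law (+ suc x) (+ suc y) (+ suc z)) (T₃-+ Y₃ _))
    (trans (sym (T₂-+ X₂ X₂′)) (trans (T₂-cong λ a b x y → L₂-law (+ suc a) (+ suc b) (+ suc x) (+ suc y))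
      (trans (T₂-+ _ _) (cong (_+ T₂ (λ _ _ x y → value₂ L₂ (+ x) (+ y))) (T₂-+ Y₂ Y₂′)))))
    (trans (T₁-cong λ a x → L₁-law (+ suc a) (+ suc x)) (T₁-+ Y₁ _))
    (begin
      T₃ X₃ + T₂ X₂
        ≡⟨ cong (λ t → T₃ X₃ + t) (T₂-cong λ a b x y → cong₂ _+_
             (∑-below A₁-law x (+ suc x) (+ suc y) (λ i j → F i j (suc y)) λ i j eq → cong (λ t → value₃ f (+ i) t (+ suc y)) eq)
             (∑-below A₂-law y (+ suc x) (+ suc y) (λ i j → F i (suc x) j) λ i j eq → cong (value₃ f (+ i) (+ suc x)) eq)) ⟨
      _ ≡⟨ P₁₂-split W₃ ⟨
      P₁₂ W₃
        ≡⟨ P₁₂-dual W₃ ⟩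
      P₁₂ (dual₃ W₃)
        ≡⟨ P₁₂-split (dual₃ W₃) ⟩
      _ ≡⟨ cong₂ _+_ (T₃-dual _) (T₂-dual _) ⟩
      -- The conjugated weight does not depend on how the multiplicity is divided, so each inner sum
      -- consists of equal terms. This is the source of the factors `a - 1` and `b - 1`.
      _ ≡⟨ cong (λ t → T₃ Y₃ + t) (T₂-cong λ a b x y → cong₂ _+_
             (∑-const a _) (∑-const b _)) ⟩
      T₃ Y₃ + T₂ Y₂ ∎)
    (begin
      T₂ X₂′ + T₁ X₁
        ≡⟨ cong (λ t → T₂ X₂′ + t) (T₁-cong λ a x →
             ∑-below B₁-law x (+ suc a) (+ suc x) (H (suc a)) λ i j eq → cong (value₃ h (+ suc a) (+ i)) eq) ⟨
      _ ≡⟨ P₁₁-split W₂ ⟨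
      P₁₁ W₂
        ≡⟨ P₁₁-dual W₂ ⟩
      P₁₁ (dual₂ W₂)
        ≡⟨ P₁₁-split (dual₂ W₂) ⟩
      _ ≡⟨ cong₂ _+_ (T₂-dual _) (T₁-dual _) ⟩
      _ ≡⟨ cong (λ t → T₂ Y₂′ + t) (T₁-cong λ a x →
             ∑-below B₂-law a (+ suc x) (+ suc a) (λ i j → H j (suc x) (suc x))
               λ i j eq → cong (λ t → value₃ h t (+ suc x) (+ suc x)) eq) ⟩
      T₂ Y₂′ + T₁ Y₁ ∎)
    where
    F H : ℕ → ℕ → ℕ → ℤ
    F x y z = value₃ f (+ x) (+ y) (+ z)
    H b x y = value₃ h (+ b) (+ x) (+ y)
    W₃ : Weight₃
    W₃ _ _ _ x y z = F x y z
    W₂ : Weight₂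
    W₂ _ b x y = H b x y
    X₃ Y₃ : Weight₃
    X₃ _ _ _ x y z = F z x y + (F y x z + F x y z)
    Y₃ _ _ _ x y z = F x (x ℕ.+ y) z + (F (x ℕ.+ y) x (y ℕ.+ z) + F (x ℕ.+ (y ℕ.+ z)) x y)
    X₂ X₂′ Y₂ Y₂′ : Weight₂
    X₂ _ _ x y = value₃ A₁ (+ x - 1ℤ) (+ x) (+ y) + value₃ A₂ (+ y - 1ℤ) (+ x) (+ y)
    X₂′ a b x y = H (a ℕ.+ b) y x + H a x y
    Y₂ a b x y = (+ a - 1ℤ) * F (x ℕ.+ y) x y + (+ b - 1ℤ) * F x x y
    Y₂′ a b x y = H a x (x ℕ.+ y) + H b (x ℕ.+ y) x
    X₁ Y₁ : Weight₁
    X₁ a x = value₃ B₁ (+ x - 1ℤ) (+ a) (+ x)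
    Y₁ a x = value₃ B₂ (+ a - 1ℤ) (+ x) (+ a)

-- Verification of certificates by polynomial normalisation

module _ where
  open ℤ-Solver

  power : ∀ {n} → Polynomial n → ℕ → Polynomial n
  power p zero    = con 1ℤ
  power p (suc e) = p :* power p e

  monomialˢ : ∀ {l n} → Vec ℕ l → Vec (Polynomial n) l → Polynomial n
  monomialˢ []       []       = con 1ℤ
  monomialˢ (e ∷ es) (x ∷ xs) = power x e :* monomialˢ es xs

  valueˢ : ∀ {l n} → Poly l → Vec (Polynomial n) l → Polynomial n
  valueˢ []            xs = con 0ℤ
  valueˢ ((m , e) ∷ p) xs = con m :* monomialˢ e xs :+ valueˢ p xs

  module _ {n} (ρ : Env n) where

    power-sound : ∀ p e → ⟦ power p e ⟧ ρ ≡ ⟦ p ⟧ ρ ^ e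
    power-sound p zero    = refl
    power-sound p (suc e) = cong (λ t → ⟦ p ⟧ ρ * t) (power-sound p e)

    monomialˢ-sound : ∀ {l} e (xs : Vec (Polynomial n) l) →
      ⟦ monomialˢ e xs ⟧ ρ ≡ monomial e (Vec.map (λ x → ⟦ x ⟧ ρ) xs)
    monomialˢ-sound []      []       = refl
    monomialˢ-sound (e ∷ es) (x ∷ xs) = cong₂ _*_ (power-sound x e) (monomialˢ-sound es xs)

    valueˢ-sound : ∀ {l} p (xs : Vec (Polynomial n) l) →
      ⟦ valueˢ p xs ⟧ ρ ≡ value p (Vec.map (λ x → ⟦ x ⟧ ρ) xs)
    valueˢ-sound []            xs = refl
    valueˢ-sound ((m , e) ∷ p) xs = cong₂ _+_ (cong (λ t → m * t) (monomialˢ-sound e xs)) (valueˢ-sound p xs)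

  Equation : ℕ → Set
  Equation n = Polynomial n × Polynomial n

  -- Both normal forms are closed terms here, whereas the hypothesis of solve evaluates them at variables,
  -- where integer multiplication unfolds exponentially.
  Valid : ∀ {n} → Equation n → Set
  Valid (p , q) = Is-just (normalise p ≟N normalise q)

  valid-sound : ∀ {n} (eq : Equation n) → Valid eq → ∀ ρ {u v} →
    ⟦ proj₁ eq ⟧ ρ ≡ u → ⟦ proj₂ eq ⟧ ρ ≡ v → u ≡ v
  valid-sound (p , q) valid ρ eu ev =
    trans (sym eu) (trans (sym (correct p ρ)) (trans (⟦ to-witness valid ⟧N-cong ρ) (trans (correct q ρ) ev)))

  module Checker (f h A₁ A₂ B₁ B₂ L₃ : Poly 3) (L₂ : Poly 2) (L₁ : Poly 1) where

    value₃ˢ : ∀ {n} → Poly 3 → (x y z : Polynomial n) → Polynomial n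
    value₃ˢ p x y z = valueˢ p (x ∷ y ∷ z ∷ [])

    one : ∀ {n} → Polynomial n
    one = con 1ℤ

    x₀ : ∀ {n} → Polynomial (suc n)
    x₀ = var 0F

    x₁ : ∀ {n} → Polynomial (suc (suc n))
    x₁ = var 1F

    x₂ : ∀ {n} → Polynomial (suc (suc (suc n)))
    x₂ = var 2F

    x₃ : Polynomial 4
    x₃ = var 3F

    antidifference-zero : Poly 3 → Equation 2
    antidifference-zero A = value₃ˢ A (con 0ℤ) x₀ x₁ , con 0ℤ

    antidifference-suc : Poly 3 → Polynomial 3 → Equation 3
    antidifference-suc A g = value₃ˢ A (one :+ x₀) x₁ x₂ , value₃ˢ A x₀ x₁ x₂ :+ g

    A₁-step A₂-step B₁-step B₂-step : Polynomial 3
    A₁-step = value₃ˢ f (one :+ x₀) (x₁ :- (one :+ x₀)) x₂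
    A₂-step = value₃ˢ f (one :+ x₀) x₁ (x₂ :- (one :+ x₀))
    B₁-step = value₃ˢ h x₁ (one :+ x₀) (x₂ :- (one :+ x₀))
    B₂-step = value₃ˢ h (x₂ :- (one :+ x₀)) x₁ x₁

    A₁-equation A₂-equation B₁-equation B₂-equation L₃-equation : Equation 3
    A₁-equation = antidifference-suc A₁ A₁-step
    A₂-equation = antidifference-suc A₂ A₂-step
    B₁-equation = antidifference-suc B₁ B₁-step
    B₂-equation = antidifference-suc B₂ B₂-step
    L₃-equation =
      (value₃ˢ f x₂ x₀ x₁ :+ (value₃ˢ f x₁ x₀ x₂ :+ value₃ˢ f x₀ x₁ x₂)) ,
      ((value₃ˢ f x₀ (x₀ :+ x₁) x₂ :+ (value₃ˢ f (x₀ :+ x₁) x₀ (x₁ :+ x₂) :+ value₃ˢ f (x₀ :+ (x₁ :+ x₂)) x₀ x₁))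
        :+ value₃ˢ L₃ x₀ x₁ x₂)

    L₂-equation : Equation 4
    L₂-equation =
      ((value₃ˢ A₁ (x₂ :- one) x₂ x₃ :+ value₃ˢ A₂ (x₃ :- one) x₂ x₃)
        :+ (value₃ˢ h (x₀ :+ x₁) x₃ x₂ :+ value₃ˢ h x₀ x₂ x₃)) ,
      ((((x₀ :- one) :* value₃ˢ f (x₂ :+ x₃) x₂ x₃ :+ (x₁ :- one) :* value₃ˢ f x₂ x₂ x₃)
        :+ (value₃ˢ h x₀ x₂ (x₂ :+ x₃) :+ value₃ˢ h x₁ (x₂ :+ x₃) x₂))
        :+ valueˢ L₂ (x₂ ∷ x₃ ∷ []))

    L₁-equation : Equation 2
    L₁-equation = value₃ˢ B₁ (x₁ :- one) x₀ x₁ , value₃ˢ B₂ (x₀ :- one) x₁ x₀ :+ valueˢ L₁ (x₁ ∷ [])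

    antidifference-sound : ∀ {A} {g : ℤ → ℤ → ℤ → ℤ} gˢ →
      (∀ i x y → ⟦ gˢ ⟧ (i ∷ x ∷ y ∷ []) ≡ g (1ℤ + i) x y) →
      Valid (antidifference-zero A) → Valid (antidifference-suc A gˢ) → IsAntidifference A g
    antidifference-sound {A} gˢ eq valid₀ valid₁ = record
      { zero-law = λ x y → valid-sound (antidifference-zero A) valid₀ (x ∷ y ∷ []) (valueˢ-sound _ A _) refl
      ; suc-law  = λ i x y → valid-sound (antidifference-suc A gˢ) valid₁ (i ∷ x ∷ y ∷ [])
          (valueˢ-sound _ A _) (cong₂ _+_ (valueˢ-sound _ A _) (eq i x y))
      }

    certify :
      Valid (antidifference-zero A₁) → Valid (antidifference-zero A₂) →
      Valid (antidifference-zero B₁) → Valid (antidifference-zero B₂) →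
      Valid A₁-equation → Valid A₂-equation → Valid B₁-equation → Valid B₂-equation →
      Valid L₃-equation → Valid L₂-equation → Valid L₁-equation → Certificate
    certify a₁ a₂ b₁ b₂ a₁′ a₂′ b₁′ b₂′ l₃ l₂ l₁ = record
      { f = f ; h = h ; A₁ = A₁ ; A₂ = A₂ ; B₁ = B₁ ; B₂ = B₂ ; L₃ = L₃ ; L₂ = L₂ ; L₁ = L₁
      ; A₁-law = antidifference-sound A₁-step (λ i x y → valueˢ-sound (i ∷ x ∷ y ∷ []) f _) a₁ a₁′
      ; A₂-law = antidifference-sound A₂-step (λ i x y → valueˢ-sound (i ∷ x ∷ y ∷ []) f _) a₂ a₂′
      ; B₁-law = antidifference-sound B₁-step (λ i x y → valueˢ-sound (i ∷ x ∷ y ∷ []) h _) b₁ b₁′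
      ; B₂-law = antidifference-sound B₂-step (λ i x y → valueˢ-sound (i ∷ x ∷ y ∷ []) h _) b₂ b₂′
      ; L₃-law = λ x y z → let s = λ p → valueˢ-sound (x ∷ y ∷ z ∷ []) {3} p in
          valid-sound L₃-equation l₃ (x ∷ y ∷ z ∷ [])
            (cong₂ _+_ (s f _) (cong₂ _+_ (s f _) (s f _)))
            (cong₂ _+_ (cong₂ _+_ (s f _) (cong₂ _+_ (s f _) (s f _))) (s L₃ _))
      ; L₂-law = λ a b x y → let ρ = a ∷ b ∷ x ∷ y ∷ []; s = λ p → valueˢ-sound ρ {3} p in
          valid-sound L₂-equation l₂ ρ
            (cong₂ _+_ (cong₂ _+_ (s A₁ _) (s A₂ _)) (cong₂ _+_ (s h _) (s h _)))
            (cong₂ _+_ (cong₂ _+_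
              (cong₂ _+_ (cong (λ t → (a - 1ℤ) * t) (s f _)) (cong (λ t → (b - 1ℤ) * t) (s f _)))
              (cong₂ _+_ (s h _) (s h _))) (valueˢ-sound ρ L₂ _))
      ; L₁-law = λ a x → let ρ = a ∷ x ∷ [] in
          valid-sound L₁-equation l₁ ρ (valueˢ-sound ρ B₁ _)
            (cong₂ _+_ (valueˢ-sound ρ B₂ _) (valueˢ-sound ρ L₁ _))
      }


-- The solutions below come from linear algebra, scaled by 24, 6, 6 and 120 to have integral coefficients.

module Weight5 where
  f h A₁ A₂ B₁ B₂ L₃ : Poly 3
  L₂ : Poly 2
  L₁ : Poly 1
  -- Here f = 24y(4y - 3x) and h = 24by(y - x) + 4x(x - 1)(x - 2). The part of `h` linear in b frees
  -- `L₂-law` of a and b. It vanishes at y = x, hence is absent from `B₂`, but leaves 4ax(x - 1)(x -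
  -- 2) in `L₁-law` through `B₁`; the second part of `h` contributes a - 1 copies of 4x(x - 1)(x -
  -- 2) through `B₂` and so cancels it.
  f = (- + 72 , 1 ∷ 1 ∷ 0 ∷ []) ∷ (+ 96 , 0 ∷ 2 ∷ 0 ∷ []) ∷ []
  h = (- + 24 , 1 ∷ 1 ∷ 1 ∷ []) ∷ (+ 24 , 1 ∷ 0 ∷ 2 ∷ []) ∷ (+ 4 , 0 ∷ 3 ∷ 0 ∷ []) ∷
      (- + 12 , 0 ∷ 2 ∷ 0 ∷ []) ∷ (+ 8 , 0 ∷ 1 ∷ 0 ∷ []) ∷ []
  -- As brackets: 240[3,1,1] - 120[2,2,1].
  L₃ = (+ 120 , 2 ∷ 0 ∷ 0 ∷ []) ∷ (- + 120 , 1 ∷ 1 ∷ 0 ∷ []) ∷ []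
  L₂ = (+ 16 , 3 ∷ 0 ∷ []) ∷ (+ 84 , 2 ∷ 1 ∷ []) ∷ (- + 84 , 2 ∷ 0 ∷ []) ∷ (- + 48 , 1 ∷ 2 ∷ []) ∷
       (- + 12 , 1 ∷ 1 ∷ []) ∷ (+ 20 , 1 ∷ 0 ∷ []) ∷ []
  L₁ = (+ 1 , 4 ∷ []) ∷ (- + 2 , 3 ∷ []) ∷ (- + 1 , 2 ∷ []) ∷ (+ 2 , 1 ∷ []) ∷ []
  A₁ = (+ 56 , 3 ∷ 0 ∷ 0 ∷ []) ∷ (- + 132 , 2 ∷ 1 ∷ 0 ∷ []) ∷ (+ 84 , 2 ∷ 0 ∷ 0 ∷ []) ∷
       (+ 96 , 1 ∷ 2 ∷ 0 ∷ []) ∷ (- + 132 , 1 ∷ 1 ∷ 0 ∷ []) ∷ (+ 28 , 1 ∷ 0 ∷ 0 ∷ []) ∷ []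
  A₂ = (- + 36 , 2 ∷ 1 ∷ 0 ∷ []) ∷ (+ 96 , 1 ∷ 2 ∷ 0 ∷ []) ∷ (- + 36 , 1 ∷ 1 ∷ 0 ∷ []) ∷ []
  B₁ = (+ 1 , 4 ∷ 0 ∷ 0 ∷ []) ∷ (+ 16 , 3 ∷ 1 ∷ 0 ∷ []) ∷ (- + 2 , 3 ∷ 0 ∷ 0 ∷ []) ∷
       (- + 36 , 2 ∷ 1 ∷ 1 ∷ []) ∷ (+ 24 , 2 ∷ 1 ∷ 0 ∷ []) ∷ (- + 1 , 2 ∷ 0 ∷ 0 ∷ []) ∷
       (+ 24 , 1 ∷ 1 ∷ 2 ∷ []) ∷ (- + 36 , 1 ∷ 1 ∷ 1 ∷ []) ∷ (+ 8 , 1 ∷ 1 ∷ 0 ∷ []) ∷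
       (+ 2 , 1 ∷ 0 ∷ 0 ∷ []) ∷ []
  B₂ = (+ 4 , 1 ∷ 3 ∷ 0 ∷ []) ∷ (- + 12 , 1 ∷ 2 ∷ 0 ∷ []) ∷ (+ 8 , 1 ∷ 1 ∷ 0 ∷ []) ∷ []

  certificate : Certificate
  certificate = Checker.certify f h A₁ A₂ B₁ B₂ L₃ L₂ L₁
    (just tt) (just tt) (just tt) (just tt) (just tt) (just tt) (just tt) (just tt)
    (just tt) (just tt) (just tt)

module Weight6₁ where
  f h A₁ A₂ B₁ B₂ L₃ : Poly 3
  L₂ : Poly 2
  L₁ : Poly 1
  f = (- + 18 , 2 ∷ 1 ∷ 0 ∷ []) ∷ (+ 6 , 2 ∷ 0 ∷ 1 ∷ []) ∷ (+ 18 , 1 ∷ 2 ∷ 0 ∷ []) ∷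
      (- + 6 , 1 ∷ 0 ∷ 2 ∷ []) ∷ (+ 6 , 0 ∷ 2 ∷ 1 ∷ []) ∷ (+ 6 , 0 ∷ 1 ∷ 2 ∷ []) ∷ []
  -- h = 6bxy(y - x) is antisymmetric in x and y. Hence both sums over coinciding parts vanish, and
  -- with them `L₁`.
  h = (- + 6 , 1 ∷ 2 ∷ 1 ∷ []) ∷ (+ 6 , 1 ∷ 1 ∷ 2 ∷ []) ∷ []
  -- As brackets: 48[3,1,2].
  L₃ = (+ 24 , 2 ∷ 0 ∷ 1 ∷ []) ∷ []
  L₂ = (+ 4 , 3 ∷ 1 ∷ []) ∷ (+ 12 , 2 ∷ 2 ∷ []) ∷ (- + 12 , 2 ∷ 1 ∷ []) ∷ (- + 4 , 1 ∷ 3 ∷ []) ∷ []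
  L₁ = []
  A₁ = (+ 9 , 4 ∷ 0 ∷ 0 ∷ []) ∷ (- + 18 , 3 ∷ 1 ∷ 0 ∷ []) ∷ (+ 4 , 3 ∷ 0 ∷ 1 ∷ []) ∷
       (+ 18 , 3 ∷ 0 ∷ 0 ∷ []) ∷ (+ 9 , 2 ∷ 2 ∷ 0 ∷ []) ∷ (- + 6 , 2 ∷ 1 ∷ 1 ∷ []) ∷
       (- + 27 , 2 ∷ 1 ∷ 0 ∷ []) ∷ (- + 6 , 2 ∷ 0 ∷ 2 ∷ []) ∷ (+ 6 , 2 ∷ 0 ∷ 1 ∷ []) ∷
       (+ 9 , 2 ∷ 0 ∷ 0 ∷ []) ∷ (+ 6 , 1 ∷ 2 ∷ 1 ∷ []) ∷ (+ 9 , 1 ∷ 2 ∷ 0 ∷ []) ∷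
       (+ 6 , 1 ∷ 1 ∷ 2 ∷ []) ∷ (- + 6 , 1 ∷ 1 ∷ 1 ∷ []) ∷ (- + 9 , 1 ∷ 1 ∷ 0 ∷ []) ∷
       (- + 6 , 1 ∷ 0 ∷ 2 ∷ []) ∷ (+ 2 , 1 ∷ 0 ∷ 1 ∷ []) ∷ []
  A₂ = (- + 3 , 4 ∷ 0 ∷ 0 ∷ []) ∷ (- + 4 , 3 ∷ 1 ∷ 0 ∷ []) ∷ (+ 6 , 3 ∷ 0 ∷ 1 ∷ []) ∷
       (- + 6 , 3 ∷ 0 ∷ 0 ∷ []) ∷ (+ 6 , 2 ∷ 2 ∷ 0 ∷ []) ∷ (- + 6 , 2 ∷ 1 ∷ 1 ∷ []) ∷
       (- + 6 , 2 ∷ 1 ∷ 0 ∷ []) ∷ (- + 3 , 2 ∷ 0 ∷ 2 ∷ []) ∷ (+ 9 , 2 ∷ 0 ∷ 1 ∷ []) ∷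
       (- + 3 , 2 ∷ 0 ∷ 0 ∷ []) ∷ (+ 6 , 1 ∷ 2 ∷ 1 ∷ []) ∷ (+ 6 , 1 ∷ 2 ∷ 0 ∷ []) ∷
       (+ 6 , 1 ∷ 1 ∷ 2 ∷ []) ∷ (- + 6 , 1 ∷ 1 ∷ 1 ∷ []) ∷ (- + 2 , 1 ∷ 1 ∷ 0 ∷ []) ∷
       (- + 3 , 1 ∷ 0 ∷ 2 ∷ []) ∷ (+ 3 , 1 ∷ 0 ∷ 1 ∷ []) ∷ []
  B₁ = (+ 3 , 4 ∷ 1 ∷ 0 ∷ []) ∷ (- + 6 , 3 ∷ 1 ∷ 1 ∷ []) ∷ (+ 6 , 3 ∷ 1 ∷ 0 ∷ []) ∷
       (+ 3 , 2 ∷ 1 ∷ 2 ∷ []) ∷ (- + 9 , 2 ∷ 1 ∷ 1 ∷ []) ∷ (+ 3 , 2 ∷ 1 ∷ 0 ∷ []) ∷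
       (+ 3 , 1 ∷ 1 ∷ 2 ∷ []) ∷ (- + 3 , 1 ∷ 1 ∷ 1 ∷ []) ∷ []
  B₂ = []

  certificate : Certificate
  certificate = Checker.certify f h A₁ A₂ B₁ B₂ L₃ L₂ L₁
    (just tt) (just tt) (just tt) (just tt) (just tt) (just tt) (just tt) (just tt)
    (just tt) (just tt) (just tt)

module Weight6₂ where
  f h A₁ A₂ B₁ B₂ L₃ : Poly 3
  L₂ : Poly 2
  L₁ : Poly 1
  -- f = 6z(x - y)(x - y - z) vanishes under both substitutions in the factors of `a - 1` and
  -- `b - 1`, namely (x + y, x, y) and (x, x, y). No term needs to be cancelled, so `h` is zero.
  f = (+ 6 , 2 ∷ 0 ∷ 1 ∷ []) ∷ (- + 12 , 1 ∷ 1 ∷ 1 ∷ []) ∷ (- + 6 , 1 ∷ 0 ∷ 2 ∷ []) ∷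
      (+ 6 , 0 ∷ 2 ∷ 1 ∷ []) ∷ (+ 6 , 0 ∷ 1 ∷ 2 ∷ []) ∷ []
  h = []
  -- As brackets: 12 times [3,2,1] + 2[3,1,2] + [2,3,1] - 3[2,2,2].
  L₃ = (+ 6 , 2 ∷ 1 ∷ 0 ∷ []) ∷ (+ 12 , 2 ∷ 0 ∷ 1 ∷ []) ∷ (+ 6 , 1 ∷ 2 ∷ 0 ∷ []) ∷
       (- + 36 , 1 ∷ 1 ∷ 1 ∷ []) ∷ []
  L₂ = (+ 2 , 3 ∷ 1 ∷ []) ∷ (+ 3 , 2 ∷ 2 ∷ []) ∷ (- + 9 , 2 ∷ 1 ∷ []) ∷ (- + 3 , 1 ∷ 2 ∷ []) ∷
       (+ 7 , 1 ∷ 1 ∷ []) ∷ []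
  L₁ = []
  A₁ = (+ 8 , 3 ∷ 0 ∷ 1 ∷ []) ∷ (- + 12 , 2 ∷ 1 ∷ 1 ∷ []) ∷ (- + 6 , 2 ∷ 0 ∷ 2 ∷ []) ∷
       (+ 12 , 2 ∷ 0 ∷ 1 ∷ []) ∷ (+ 6 , 1 ∷ 2 ∷ 1 ∷ []) ∷ (+ 6 , 1 ∷ 1 ∷ 2 ∷ []) ∷
       (- + 12 , 1 ∷ 1 ∷ 1 ∷ []) ∷ (- + 6 , 1 ∷ 0 ∷ 2 ∷ []) ∷ (+ 4 , 1 ∷ 0 ∷ 1 ∷ []) ∷ []
  A₂ = (- + 3 , 4 ∷ 0 ∷ 0 ∷ []) ∷ (+ 6 , 3 ∷ 1 ∷ 0 ∷ []) ∷ (+ 6 , 3 ∷ 0 ∷ 1 ∷ []) ∷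
       (- + 6 , 3 ∷ 0 ∷ 0 ∷ []) ∷ (- + 3 , 2 ∷ 2 ∷ 0 ∷ []) ∷ (- + 12 , 2 ∷ 1 ∷ 1 ∷ []) ∷
       (+ 9 , 2 ∷ 1 ∷ 0 ∷ []) ∷ (- + 3 , 2 ∷ 0 ∷ 2 ∷ []) ∷ (+ 9 , 2 ∷ 0 ∷ 1 ∷ []) ∷
       (- + 3 , 2 ∷ 0 ∷ 0 ∷ []) ∷ (+ 6 , 1 ∷ 2 ∷ 1 ∷ []) ∷ (- + 3 , 1 ∷ 2 ∷ 0 ∷ []) ∷
       (+ 6 , 1 ∷ 1 ∷ 2 ∷ []) ∷ (- + 12 , 1 ∷ 1 ∷ 1 ∷ []) ∷ (+ 3 , 1 ∷ 1 ∷ 0 ∷ []) ∷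
       (- + 3 , 1 ∷ 0 ∷ 2 ∷ []) ∷ (+ 3 , 1 ∷ 0 ∷ 1 ∷ []) ∷ []
  B₁ = []
  B₂ = []

  certificate : Certificate
  certificate = Checker.certify f h A₁ A₂ B₁ B₂ L₃ L₂ L₁
    (just tt) (just tt) (just tt) (just tt) (just tt) (just tt) (just tt) (just tt)
    (just tt) (just tt) (just tt)

module Weight6₃ where
  f h A₁ A₂ B₁ B₂ L₃ : Poly 3
  L₂ : Poly 2
  L₁ : Poly 1
  -- f = 120xy(2z - y) and h = -120by(x - y)² - 20x²(x - 1)(x - 2). As in weight 5, the part of `h`
  -- linear in b serves `L₂-law` and vanishes at y = x, and the rest removes a from `L₁-law`.
  f = (- + 120 , 1 ∷ 2 ∷ 0 ∷ []) ∷ (+ 240 , 1 ∷ 1 ∷ 1 ∷ []) ∷ []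
  h = (- + 120 , 1 ∷ 2 ∷ 1 ∷ []) ∷ (+ 240 , 1 ∷ 1 ∷ 2 ∷ []) ∷ (- + 120 , 1 ∷ 0 ∷ 3 ∷ []) ∷
      (- + 20 , 0 ∷ 4 ∷ 0 ∷ []) ∷ (+ 60 , 0 ∷ 3 ∷ 0 ∷ []) ∷ (- + 40 , 0 ∷ 2 ∷ 0 ∷ []) ∷ []
  -- As brackets: 240 times 9[4,1,1] - [3,2,1] - 4[3,1,2] - 4[2,3,1].
  L₃ = (+ 360 , 3 ∷ 0 ∷ 0 ∷ []) ∷ (- + 120 , 2 ∷ 1 ∷ 0 ∷ []) ∷ (- + 480 , 2 ∷ 0 ∷ 1 ∷ []) ∷
       (- + 480 , 1 ∷ 2 ∷ 0 ∷ []) ∷ []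
  L₂ = (+ 10 , 4 ∷ 0 ∷ []) ∷ (+ 120 , 3 ∷ 1 ∷ []) ∷ (- + 300 , 3 ∷ 0 ∷ []) ∷ (+ 60 , 2 ∷ 2 ∷ []) ∷
       (+ 240 , 2 ∷ 1 ∷ []) ∷ (+ 50 , 2 ∷ 0 ∷ []) ∷ (+ 120 , 1 ∷ 3 ∷ []) ∷ (+ 60 , 1 ∷ 2 ∷ []) ∷ []
  L₁ = (- + 4 , 5 ∷ []) ∷ (+ 5 , 4 ∷ []) ∷ (+ 10 , 3 ∷ []) ∷ (- + 5 , 2 ∷ []) ∷ (- + 6 , 1 ∷ []) ∷ []
  A₁ = (- + 30 , 4 ∷ 0 ∷ 0 ∷ []) ∷ (+ 80 , 3 ∷ 1 ∷ 0 ∷ []) ∷ (- + 80 , 3 ∷ 0 ∷ 1 ∷ []) ∷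
       (- + 60 , 3 ∷ 0 ∷ 0 ∷ []) ∷ (- + 60 , 2 ∷ 2 ∷ 0 ∷ []) ∷ (+ 120 , 2 ∷ 1 ∷ 1 ∷ []) ∷
       (+ 120 , 2 ∷ 1 ∷ 0 ∷ []) ∷ (- + 120 , 2 ∷ 0 ∷ 1 ∷ []) ∷ (- + 30 , 2 ∷ 0 ∷ 0 ∷ []) ∷
       (- + 60 , 1 ∷ 2 ∷ 0 ∷ []) ∷ (+ 120 , 1 ∷ 1 ∷ 1 ∷ []) ∷ (+ 40 , 1 ∷ 1 ∷ 0 ∷ []) ∷
       (- + 40 , 1 ∷ 0 ∷ 1 ∷ []) ∷ []
  A₂ = (- + 80 , 3 ∷ 1 ∷ 0 ∷ []) ∷ (- + 60 , 2 ∷ 2 ∷ 0 ∷ []) ∷ (+ 120 , 2 ∷ 1 ∷ 1 ∷ []) ∷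
       (- + 120 , 2 ∷ 1 ∷ 0 ∷ []) ∷ (- + 60 , 1 ∷ 2 ∷ 0 ∷ []) ∷ (+ 120 , 1 ∷ 1 ∷ 1 ∷ []) ∷
       (- + 40 , 1 ∷ 1 ∷ 0 ∷ []) ∷ []
  B₁ = (- + 4 , 5 ∷ 0 ∷ 0 ∷ []) ∷ (+ 120 , 4 ∷ 1 ∷ 0 ∷ []) ∷ (+ 5 , 4 ∷ 0 ∷ 0 ∷ []) ∷
       (- + 320 , 3 ∷ 1 ∷ 1 ∷ []) ∷ (+ 240 , 3 ∷ 1 ∷ 0 ∷ []) ∷ (+ 10 , 3 ∷ 0 ∷ 0 ∷ []) ∷
       (+ 300 , 2 ∷ 1 ∷ 2 ∷ []) ∷ (- + 480 , 2 ∷ 1 ∷ 1 ∷ []) ∷ (+ 120 , 2 ∷ 1 ∷ 0 ∷ []) ∷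
       (- + 5 , 2 ∷ 0 ∷ 0 ∷ []) ∷ (- + 120 , 1 ∷ 1 ∷ 3 ∷ []) ∷ (+ 300 , 1 ∷ 1 ∷ 2 ∷ []) ∷
       (- + 160 , 1 ∷ 1 ∷ 1 ∷ []) ∷ (- + 6 , 1 ∷ 0 ∷ 0 ∷ []) ∷ []
  B₂ = (- + 20 , 1 ∷ 4 ∷ 0 ∷ []) ∷ (+ 60 , 1 ∷ 3 ∷ 0 ∷ []) ∷ (- + 40 , 1 ∷ 2 ∷ 0 ∷ []) ∷ []

  certificate : Certificate
  certificate = Checker.certify f h A₁ A₂ B₁ B₂ L₃ L₂ L₁
    (just tt) (just tt) (just tt) (just tt) (just tt) (just tt) (just tt) (just tt)
    (just tt) (just tt) (just tt)


-- Coefficients of brackets as weighted partition sums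

pos-^ : ∀ v r → + (v ℕ.^ r) ≡ (+ v) ^ r
pos-^ v zero    = refl
pos-^ v (suc r) = trans (ℤP.pos-* v (v ℕ.^ r)) (cong (λ t → + v * t) (pos-^ v r))

pos-sumFrom1 : ∀ m f → + sumFrom1 m f ≡ ∑ m (λ i → + f i)
pos-sumFrom1 zero    f = refl
pos-sumFrom1 (suc m) f = begin
  + sum (map f′ (upTo (suc m)))                ≡⟨ cong (λ l → + sum (map f′ l)) (upTo-∷ʳ m) ⟨
  + sum (map f′ (upTo m ∷ʳ m))                 ≡⟨ cong (λ l → + sum l) (map-++ f′ (upTo m) (m ∷ [])) ⟩
  + sum (map f′ (upTo m) ∷ʳ f′ m)              ≡⟨ cong +_ (sum-++ (map f′ (upTo m)) (f′ m ∷ [])) ⟩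
  + (sum (map f′ (upTo m)) ℕ.+ (f′ m ℕ.+ 0))   ≡⟨ cong (λ t → + (sum (map f′ (upTo m)) ℕ.+ t)) (ℕP.+-identityʳ (f′ m)) ⟩
  + sumFrom1 m f + + f′ m                      ≡⟨ cong (_+ + f′ m) (pos-sumFrom1 m f) ⟩
  ∑ m (λ i → + f i) + + f′ m                   ∎
  where
  f′ : ℕ → ℕ
  f′ i = f (suc i)

if-≤ : ∀ {A : Set} {m n} {x y : A} → m ≤ n → (if m ≤ᵇ n then x else y) ≡ x
if-≤ {m = m} {n} {x} {y} m≤n = cong (if_then x else y) (dec-true (m ℕ.≤? n) m≤n)

if-> : ∀ {A : Set} {m n} {x y : A} → n < m → (if m ≤ᵇ n then x else y) ≡ y
if-> {m = m} {n} {x} {y} n<m = cong (if_then x else y) (dec-false (m ℕ.≤? n) (ℕP.<⇒≱ n<m))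

module Coefficient (n : ℕ) where

  -- The indicator of `q = n`, written through `sigmaAux []` so that it matches the innermost value
  -- of the given recursion.
  K : ℕ → ℤ
  K q = if q ≤ᵇ n then + sigmaAux [] 0 (n ∸ q) else 0ℤ

  K-vanish : ∀ {q} → n < q → K q ≡ 0ℤ
  K-vanish lt = if-> lt

  open Splitting n K K-vanish

  -- Instead of subtracting from `n`, the argument `q` accumulates the amount already used. The test
  -- is postponed to `K` and every multiplicity runs up to the fixed `n`, so the sums can be
  -- reordered.
  nestedSum : List ℕ → ℕ → ℕ → ℤ
  nestedSum []       b q = K q
  nestedSum (r ∷ rs) b q = ∑ (b ∸ 1) λ u → ∑ n λ v → (+ v) ^ r * nestedSum rs u (q ℕ.+ u ℕ.* v)

  nestedSum-vanish : ∀ rs b q → n < q → nestedSum rs b q ≡ 0ℤ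
  nestedSum-vanish []       b q lt = K-vanish lt
  nestedSum-vanish (r ∷ rs) b q lt = ∑-zero (b ∸ 1) λ u → ∑-zero n λ v →
    trans (cong (λ t → (+ suc v) ^ r * t) (nestedSum-vanish rs (suc u) _ (ℕP.<-≤-trans lt (ℕP.m≤m+n q _))))
      (ℤP.*-zeroʳ ((+ suc v) ^ r))

  -- The terms that the recursion for `sigmaAux` excludes, by its test or by its shorter range
  -- `n ∸ q`, overshoot `n` and vanish on the other side.
  nestedSum≡sigmaAux : ∀ rs b q → q ≤ n → nestedSum rs b q ≡ + sigmaAux rs b (n ∸ q)
  nestedSum≡sigmaAux []       b q q≤n = if-≤ q≤n
  nestedSum≡sigmaAux (r ∷ rs) b q q≤n = sym (begin
    + sumFrom1 (b ∸ 1) (λ u → sumFrom1 (n ∸ q) (summand u))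
      ≡⟨ pos-sumFrom1 (b ∸ 1) _ ⟩
    ∑ (b ∸ 1) (λ u → + sumFrom1 (n ∸ q) (summand u))
      ≡⟨ ∑-cong (b ∸ 1) row ⟩
    ∑ (b ∸ 1) (λ u → ∑ n (term u)) ∎)
    where
    summand : ℕ → ℕ → ℕ
    summand u v = if u ℕ.* v ≤ᵇ n ∸ q then v ℕ.^ r ℕ.* sigmaAux rs u (n ∸ q ∸ u ℕ.* v) else 0
    term : ℕ → ℕ → ℤ
    term u v = (+ v) ^ r * nestedSum rs u (q ℕ.+ u ℕ.* v)
    term-vanish : ∀ u v → n < q ℕ.+ u ℕ.* v → term u v ≡ 0ℤ
    term-vanish u v lt = trans (cong (λ t → (+ v) ^ r * t) (nestedSum-vanish rs u _ lt)) (ℤP.*-zeroʳ ((+ v) ^ r))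
    n<q+ : ∀ {k} → n ∸ q < k → n < q ℕ.+ k
    n<q+ lt = ℕP.≤-<-trans (ℕP.m≤n+m∸n n q) (ℕP.+-monoʳ-< q lt)
    pointwise : ∀ u v → + summand u v ≡ term u v
    pointwise u v with ℕP.≤-<-connex (u ℕ.* v) (n ∸ q)
    ... | inj₁ le = begin
      + summand u v
        ≡⟨ cong +_ (if-≤ le) ⟩
      + (v ℕ.^ r ℕ.* sigmaAux rs u (n ∸ q ∸ u ℕ.* v))
        ≡⟨ ℤP.pos-* (v ℕ.^ r) _ ⟩
      + (v ℕ.^ r) * + sigmaAux rs u (n ∸ q ∸ u ℕ.* v)
        ≡⟨ cong₂ _*_ (pos-^ v r) (cong (λ t → + sigmaAux rs u t) (ℕP.∸-+-assoc n q (u ℕ.* v))) ⟩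
      (+ v) ^ r * + sigmaAux rs u (n ∸ (q ℕ.+ u ℕ.* v))
        ≡⟨ cong (λ t → (+ v) ^ r * t) (nestedSum≡sigmaAux rs u _
             (subst (q ℕ.+ u ℕ.* v ≤_) (ℕP.m+[n∸m]≡n q≤n) (ℕP.+-monoʳ-≤ q le))) ⟨
      term u v ∎
    ... | inj₂ gt = trans (cong +_ (if-> gt)) (sym (term-vanish u v (n<q+ gt)))
    row : ∀ u → + sumFrom1 (n ∸ q) (summand (suc u)) ≡ ∑ n (term (suc u))
    row u = begin
      + sumFrom1 (n ∸ q) (summand (suc u))     ≡⟨ pos-sumFrom1 (n ∸ q) _ ⟩
      ∑ (n ∸ q) (λ v → + summand (suc u) v)    ≡⟨ ∑-cong (n ∸ q) (λ v → pointwise (suc u) (suc v)) ⟩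
      ∑ (n ∸ q) (term (suc u))
        ≡⟨ ∑-extend (ℕP.m∸n≤m n q) (term (suc u)) (λ v lt →
             term-vanish (suc u) v (n<q+ (ℕP.<-≤-trans lt (ℕP.m≤m+n v (u ℕ.* v))))) ⟩
      ∑ n (term (suc u)) ∎

  flatten₁ : ∀ i b q → nestedSum (i ∷ []) b q ≡
    ∑ (b ∸ 1) λ u → ∑ n λ x → K (q ℕ.+ u ℕ.* x) * monomial (i ∷ []) (+ x ∷ [])
  flatten₁ i b q = ∑-cong (b ∸ 1) λ u → ∑-cong n λ x →
    trans (ℤP.*-comm ((+ suc x) ^ i) _) (cong (λ t → K (q ℕ.+ suc u ℕ.* suc x) * t) (sym (ℤP.*-identityʳ _)))

  flatten₂ : ∀ i j b q → nestedSum (i ∷ j ∷ []) b q ≡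
    ∑ (b ∸ 1) λ u → ∑ (pred u) λ w → ∑² n λ x y →
      K (q ℕ.+ u ℕ.* x ℕ.+ w ℕ.* y) * monomial (i ∷ j ∷ []) (+ x ∷ + y ∷ [])
  flatten₂ i j b q = ∑-cong (b ∸ 1) λ u → trans
    (∑-cong n λ x → let p = (+ suc x) ^ i in begin
      p * nestedSum (j ∷ []) (suc u) (q ℕ.+ suc u ℕ.* suc x)
        ≡⟨ cong (λ t → p * t) (flatten₁ j (suc u) (q ℕ.+ suc u ℕ.* suc x)) ⟩
      p * ∑ u (λ w → ∑ n (G u x w))
        ≡⟨ ∑-*ˡ u p (λ w → ∑ n (G u x w)) ⟨
      ∑ u (λ w → p * ∑ n (G u x w))
        ≡⟨ ∑-cong u (λ w → ∑-*ˡ n p (G u x (suc w))) ⟨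
      ∑ u (λ w → ∑ n (λ y → p * G u x w y))
        ≡⟨ ∑-cong u (λ w → ∑-cong n λ y → K-scale (q ℕ.+ suc u ℕ.* suc x ℕ.+ suc w ℕ.* suc y) p _) ⟨
      ∑ u (λ w → F (suc u) w (suc x)) ∎)
    (∑-comm n u (λ x w → F (suc u) w x))
    where
    G : ℕ → ℕ → ℕ → ℕ → ℤ
    G u x w y = K (q ℕ.+ suc u ℕ.* suc x ℕ.+ w ℕ.* y) * monomial (j ∷ []) (+ y ∷ [])
    F : ℕ → ℕ → ℕ → ℤ
    F u w x = ∑ n λ y → K (q ℕ.+ u ℕ.* x ℕ.+ w ℕ.* y) * monomial (i ∷ j ∷ []) (+ x ∷ + y ∷ [])

  -- The bounds of the sums over parts do not depend on the multiplicities, so those sums can be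
  -- moved to the front, where `∑-nested` applies.
  flatten₃ : ∀ i j k b q → nestedSum (i ∷ j ∷ k ∷ []) b q ≡
    ∑ (b ∸ 1) λ u → ∑ (pred u) λ w → ∑ (pred w) λ t → ∑³ n λ x y z →
      K (q ℕ.+ u ℕ.* x ℕ.+ w ℕ.* y ℕ.+ t ℕ.* z) * monomial (i ∷ j ∷ k ∷ []) (+ x ∷ + y ∷ + z ∷ [])
  flatten₃ i j k b q = ∑-cong (b ∸ 1) λ u → begin
    ∑ n (λ x → (+ x) ^ i * nestedSum (j ∷ k ∷ []) (suc u) (q ℕ.+ suc u ℕ.* x))
      ≡⟨ ∑-cong n (λ x → let p = (+ suc x) ^ i in begin
           p * nestedSum (j ∷ k ∷ []) (suc u) (q ℕ.+ suc u ℕ.* suc x)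
             ≡⟨ cong (λ t → p * t) (flatten₂ j k (suc u) (q ℕ.+ suc u ℕ.* suc x)) ⟩
           p * ∑ u (λ w → ∑ (pred w) λ t → ∑² n (G u x w t))
             ≡⟨ ∑-*ˡ u p (λ w → ∑ (pred w) λ t → ∑² n (G u x w t)) ⟨
           ∑ u (λ w → p * ∑ (pred w) (λ t → ∑² n (G u x w t)))
             ≡⟨ ∑-cong u (λ w → ∑-*ˡ w p (λ t → ∑² n (G u x (suc w) t))) ⟨
           ∑ u (λ w → ∑ (pred w) (λ t → p * ∑² n (G u x w t)))
             ≡⟨ ∑-cong u (λ w → ∑-cong w λ t → ∑²-*ˡ n p (G u x (suc w) (suc t))) ⟨
           ∑ u (λ w → ∑ (pred w) (λ t → ∑² n (λ y z → p * G u x w t y z)))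
             ≡⟨ ∑-cong u (λ w → ∑-cong w λ t → ∑²-cong n λ y z →
                  K-scale (q ℕ.+ suc u ℕ.* suc x ℕ.+ suc w ℕ.* suc y ℕ.+ suc t ℕ.* suc z) p _) ⟨
           ∑ u (λ w → ∑ (pred w) (λ t → F (suc u) w t (suc x))) ∎) ⟩
    ∑ n (λ x → ∑ u (λ w → ∑ (pred w) (λ t → F (suc u) w t x)))
      ≡⟨ ∑-comm n u (λ x w → ∑ (pred w) (λ t → F (suc u) w t x)) ⟩
    ∑ u (λ w → ∑ n (λ x → ∑ (pred w) (λ t → F (suc u) w t x)))
      ≡⟨ ∑-cong u (λ w → ∑-comm n w (λ x t → F (suc u) (suc w) t x)) ⟩
    ∑ u (λ w → ∑ (pred w) (λ t → ∑ n (F (suc u) w t))) ∎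
    where
    G : ℕ → ℕ → ℕ → ℕ → ℕ → ℕ → ℤ
    G u x w t y z = K (q ℕ.+ suc u ℕ.* suc x ℕ.+ w ℕ.* y ℕ.+ t ℕ.* z) * monomial (j ∷ k ∷ []) (+ y ∷ + z ∷ [])
    F : ℕ → ℕ → ℕ → ℕ → ℤ
    F u w t x = ∑² n λ y z →
      K (q ℕ.+ u ℕ.* x ℕ.+ w ℕ.* y ℕ.+ t ℕ.* z) * monomial (i ∷ j ∷ k ∷ []) (+ x ∷ + y ∷ + z ∷ [])

  T₁-monomial : ∀ (e : Vec ℕ 1) → T₁ (λ _ x → monomial e (+ x ∷ [])) ≡ + σ (Vec.toList e) n
  T₁-monomial (i ∷ []) = trans (sym (flatten₁ i (suc n) 0)) (nestedSum≡sigmaAux (i ∷ []) (suc n) 0 z≤n)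

  T₂-monomial : ∀ (e : Vec ℕ 2) → T₂ (λ _ _ x y → monomial e (+ x ∷ + y ∷ [])) ≡ + σ (Vec.toList e) n
  T₂-monomial e@(i ∷ j ∷ []) = sym (begin
    + σ (i ∷ j ∷ []) n
      ≡⟨ nestedSum≡sigmaAux (i ∷ j ∷ []) (suc n) 0 z≤n ⟨
    nestedSum (i ∷ j ∷ []) (suc n) 0
      ≡⟨ flatten₂ i j (suc n) 0 ⟩
    ∑ n (λ u → ∑ (pred u) (G u))
      ≡⟨ ∑-nested n G vanish ⟩
    ∑² n (λ w c → G (w ℕ.+ c) w)
      ≡⟨ ∑²-cong n (λ a b → ∑²-cong n λ x y → K-cong
           (solve 4 (λ a b x y → (a :+ b) :* x :+ a :* y := a :* (x :+ y) :+ b :* x) refl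
             (suc a) (suc b) (suc x) (suc y)) _) ⟩
    T₂ (λ _ _ x y → monomial e (+ x ∷ + y ∷ [])) ∎)
    where
    open ℕ-Solver
    G : ℕ → ℕ → ℤ
    G u w = ∑² n λ x y → K (u ℕ.* x ℕ.+ w ℕ.* y) * monomial e (+ x ∷ + y ∷ [])
    vanish : ∀ u w → n < u → G u w ≡ 0ℤ
    vanish u w lt = ∑²-zero n λ x y → K-vanish-*
      (ℕP.<-≤-trans lt (ℕP.≤-trans (ℕP.m≤m*n u (suc x)) (ℕP.m≤m+n _ (w ℕ.* suc y)))) _

  T₃-monomial : ∀ (e : Vec ℕ 3) →
    T₃ (λ _ _ _ x y z → monomial e (+ x ∷ + y ∷ + z ∷ [])) ≡ + σ (Vec.toList e) n
  T₃-monomial e@(i ∷ j ∷ k ∷ []) = sym (begin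
    + σ (i ∷ j ∷ k ∷ []) n
      ≡⟨ nestedSum≡sigmaAux (i ∷ j ∷ k ∷ []) (suc n) 0 z≤n ⟨
    nestedSum (i ∷ j ∷ k ∷ []) (suc n) 0
      ≡⟨ flatten₃ i j k (suc n) 0 ⟩
    ∑ n (λ u → ∑ (pred u) λ w → ∑ (pred w) (G u w))
      ≡⟨ ∑-nested n (λ u w → ∑ (pred w) (G u w)) (λ u w lt → ∑-zero (pred w) λ t → vanish u w (suc t) lt) ⟩
    ∑² n (λ w c → ∑ (pred w) (G (w ℕ.+ c) w))
      -- The gap `c` is moved inside to make the sums over `w` and `t` adjacent, ready for the
      -- second passage to gaps.
      ≡⟨ ∑-cong n (λ w → ∑-comm n w (λ c → G (suc w ℕ.+ c) (suc w))) ⟩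
    ∑ n (λ w → ∑ (pred w) (G′ w))
      ≡⟨ ∑-nested n G′ (λ w t lt → ∑-zero n λ c →
           vanish (w ℕ.+ suc c) w t (ℕP.<-≤-trans lt (ℕP.m≤m+n w (suc c)))) ⟩
    ∑² n (λ t b → G′ (t ℕ.+ b) t)
      ≡⟨ ∑³-cong n (λ a b c → ∑³-cong n λ x y z → K-cong
           (solve 6 (λ a b c x y z → (a :+ b :+ c) :* x :+ (a :+ b) :* y :+ a :* z
               := a :* (x :+ y :+ z) :+ b :* (x :+ y) :+ c :* x) refl
             (suc a) (suc b) (suc c) (suc x) (suc y) (suc z)) _) ⟩
    T₃ (λ _ _ _ x y z → monomial e (+ x ∷ + y ∷ + z ∷ [])) ∎)
    where
    open ℕ-Solver
    G : ℕ → ℕ → ℕ → ℤ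
    G u w t = ∑³ n λ x y z → K (u ℕ.* x ℕ.+ w ℕ.* y ℕ.+ t ℕ.* z) * monomial e (+ x ∷ + y ∷ + z ∷ [])
    G′ : ℕ → ℕ → ℤ
    G′ w t = ∑ n λ c → G (w ℕ.+ c) w t
    vanish : ∀ u w t → n < u → G u w t ≡ 0ℤ
    vanish u w t lt = ∑³-zero n λ x y z → K-vanish-*
      (ℕP.<-≤-trans lt (ℕP.≤-trans (ℕP.≤-trans (ℕP.m≤m*n u (suc x))
        (ℕP.m≤m+n _ (w ℕ.* suc y))) (ℕP.m≤m+n _ (t ℕ.* suc z)))) _

σ-sum : ∀ {l} → Poly l → ℕ → ℤ
σ-sum []            n = 0ℤ
σ-sum ((m , e) ∷ p) n = m * + σ (Vec.toList e) n + σ-sum p n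

-- `Φ` stands for `T₁`, `T₂` or `T₃` restricted to weights in the multiplicities: linearity reduces
-- them to monomials.
linear-value : ∀ {l} n (Φ : (Vec ℤ l → ℤ) → ℤ) →
  (∀ V W → Φ (λ xs → V xs + W xs) ≡ Φ V + Φ W) →
  (∀ k W → Φ (λ xs → k * W xs) ≡ k * Φ W) →
  (∀ e → Φ (monomial e) ≡ + σ (Vec.toList e) n) →
  ∀ p → Φ (value p) ≡ σ-sum p n
-- Homogeneity with factor 0 yields the value at the zero weight.
linear-value n Φ Φ-+ Φ-* Φ-monomial []            = Φ-* 0ℤ (λ _ → 0ℤ)
linear-value n Φ Φ-+ Φ-* Φ-monomial ((m , e) ∷ p) = trans (Φ-+ (λ xs → m * monomial e xs) (value p))
  (cong₂ _+_ (trans (Φ-* m (monomial e)) (cong (λ t → m * t) (Φ-monomial e)))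
    (linear-value n Φ Φ-+ Φ-* Φ-monomial p))

σ-relation : ∀ C → let open Certificate C in ∀ n → σ-sum L₃ n + (σ-sum L₂ n + σ-sum L₁ n) ≡ 0ℤ
σ-relation C n = trans
  (sym (cong₂ _+_
    (linear-value n (λ W → T₃ λ _ _ _ x y z → W (+ x ∷ + y ∷ + z ∷ [])) (λ _ _ → T₃-+ _ _) (λ k _ → T₃-*ˡ k _) T₃-monomial L₃)
    (cong₂ _+_
      (linear-value n (λ W → T₂ λ _ _ x y → W (+ x ∷ + y ∷ [])) (λ _ _ → T₂-+ _ _) (λ k _ → T₂-*ˡ k _) T₂-monomial L₂)
      (linear-value n (λ W → T₁ λ _ x → W (+ x ∷ [])) (λ _ _ → T₁-+ _ _) (λ k _ → T₁-*ˡ k _) T₁-monomial L₁))))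
  (certified C n K K-vanish)
  where
  open Certificate C
  open Coefficient n
  open Splitting n K K-vanish


-- Passage to rational combinations of brackets

fromℤ : ℤ → ℚ
fromℤ i = i / 1

fromℚᵘ-homo-+ : ∀ p q → ℚ.fromℚᵘ (p ℚᵘ.+ q) ≡ ℚ.fromℚᵘ p ℚ.+ ℚ.fromℚᵘ q
fromℚᵘ-homo-+ p q = ℚP.toℚᵘ-injective (ℚᵘP.≃-trans (ℚP.toℚᵘ-fromℚᵘ (p ℚᵘ.+ q)) (ℚᵘP.≃-sym
  (ℚᵘP.≃-trans (ℚP.toℚᵘ-homo-+ (ℚ.fromℚᵘ p) (ℚ.fromℚᵘ q)) (ℚᵘP.+-cong (ℚP.toℚᵘ-fromℚᵘ p) (ℚP.toℚᵘ-fromℚᵘ q)))))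

fromℚᵘ-homo-* : ∀ p q → ℚ.fromℚᵘ (p ℚᵘ.* q) ≡ ℚ.fromℚᵘ p ℚ.* ℚ.fromℚᵘ q
fromℚᵘ-homo-* p q = ℚP.toℚᵘ-injective (ℚᵘP.≃-trans (ℚP.toℚᵘ-fromℚᵘ (p ℚᵘ.* q)) (ℚᵘP.≃-sym
  (ℚᵘP.≃-trans (ℚP.toℚᵘ-homo-* (ℚ.fromℚᵘ p) (ℚ.fromℚᵘ q)) (ℚᵘP.*-cong (ℚP.toℚᵘ-fromℚᵘ p) (ℚP.toℚᵘ-fromℚᵘ q)))))

fromℤ-+ : ∀ i j → fromℤ (i + j) ≡ fromℤ i ℚ.+ fromℤ j
fromℤ-+ i j = trans (ℚP.fromℚᵘ-cong {mkℚᵘ (i + j) 0} {mkℚᵘ i 0 ℚᵘ.+ mkℚᵘ j 0}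
    (*≡* (cong (_* + 1) (sym (cong₂ _+_ (ℤP.*-identityʳ i) (ℤP.*-identityʳ j))))))
  (fromℚᵘ-homo-+ (mkℚᵘ i 0) (mkℚᵘ j 0))

fromℤ-* : ∀ i j → fromℤ (i * j) ≡ fromℤ i ℚ.* fromℤ j
fromℤ-* i j = fromℚᵘ-homo-* (mkℚᵘ i 0) (mkℚᵘ j 0)

fromℤ-inverse : ∀ k .{{_ : ℕ.NonZero k}} → fromℤ (+ k) ℚ.* (+ 1 / k) ≡ 1ℚ
fromℤ-inverse k@(suc d) = trans (sym (fromℚᵘ-homo-* (mkℚᵘ (+ k) 0) (mkℚᵘ (+ 1) d)))
  (ℚP.fromℚᵘ-cong {mkℚᵘ (+ k) 0 ℚᵘ.* mkℚᵘ (+ 1) d} {ℚᵘ.1ℚᵘ} (*≡* (cong +_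
    (solve 1 (λ d → (con 1 :+ d) :* con 1 :* con 1 := con 1 :+ (d :+ con 0) :+ con 0) refl d))))
  where open ℕ-Solver

factorials : List ℕ → ℚ
factorials []       = 1ℚ
factorials (r ∷ rs) = fromℤ (+ (r !)) ℚ.* factorials rs

factorials-inverse : ∀ rs → factorials rs ℚ.* invFact (map suc rs) ≡ 1ℚ
factorials-inverse []       = refl
factorials-inverse (r ∷ rs) = begin
  (fromℤ (+ (r !)) ℚ.* factorials rs) ℚ.* (r!⁻¹ ℚ.* invFact (map suc rs))
    ≡⟨ solve 4 (λ a b c d → (a :* b) :* (c :* d) := (a :* c) :* (b :* d)) refl
         (fromℤ (+ (r !))) (factorials rs) r!⁻¹ (invFact (map suc rs)) ⟩
  (fromℤ (+ (r !)) ℚ.* r!⁻¹) ℚ.* (factorials rs ℚ.* invFact (map suc rs))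
    ≡⟨ cong₂ ℚ._*_ (fromℤ-inverse (r !) {{r ℕP.!≢0}}) (factorials-inverse rs) ⟩
  1ℚ ∎
  where
  open ℚ-Solver
  r!⁻¹ = (+ 1 / (r !)) {{r ℕP.!≢0}}

map-pred-suc : ∀ rs → map (λ x → x ∸ 1) (map suc rs) ≡ rs
map-pred-suc []       = refl
map-pred-suc (r ∷ rs) = cong (r ∷_) (map-pred-suc rs)

-- An exponent r becomes the entry r + 1, and the factorials undo the normalisation of the bracket,
-- so that evaluation returns the integral sum.
toLinComb : ∀ {l} → Poly l → LinComb
toLinComb []            = []
toLinComb ((m , e) ∷ p) =
  (fromℤ m ℚ.* factorials (Vec.toList e) , map suc (Vec.toList e)) ∷ toLinComb p

eval-toLinComb : ∀ {l} (p : Poly l) n → eval (toLinComb p) n ≡ fromℤ (σ-sum p n)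
eval-toLinComb []            n = refl
eval-toLinComb ((m , e) ∷ p) n = trans (cong₂ ℚ._+_ term (eval-toLinComb p n))
  (sym (fromℤ-+ (m * + σ rs n) (σ-sum p n)))
  where
  open ℚ-Solver
  rs = Vec.toList e
  term : (fromℤ m ℚ.* factorials rs) ℚ.* bracket (map suc rs) n ≡ fromℤ (m * + σ rs n)
  term = begin
    (fromℤ m ℚ.* factorials rs) ℚ.* (fromℤ (+ σ (map (λ x → x ∸ 1) (map suc rs)) n) ℚ.* invFact (map suc rs))
      ≡⟨ cong (λ t → (fromℤ m ℚ.* factorials rs) ℚ.* (fromℤ (+ σ t n) ℚ.* invFact (map suc rs))) (map-pred-suc rs) ⟩
    (fromℤ m ℚ.* factorials rs) ℚ.* (fromℤ (+ σ rs n) ℚ.* invFact (map suc rs))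
      ≡⟨ solve 4 (λ a b c d → (a :* b) :* (c :* d) := (a :* c) :* (b :* d)) refl
           (fromℤ m) (factorials rs) (fromℤ (+ σ rs n)) (invFact (map suc rs)) ⟩
    (fromℤ m ℚ.* fromℤ (+ σ rs n)) ℚ.* (factorials rs ℚ.* invFact (map suc rs))
      ≡⟨ cong₂ ℚ._*_ (sym (fromℤ-* m (+ σ rs n))) (factorials-inverse rs) ⟩
    fromℤ (m * + σ rs n) ℚ.* 1ℚ
      ≡⟨ ℚP.*-identityʳ _ ⟩
    fromℤ (m * + σ rs n) ∎

eval-++ : ∀ xs ys n → eval (xs ++ ys) n ≡ eval xs n ℚ.+ eval ys n
eval-++ []             ys n = sym (ℚP.+-identityˡ (eval ys n))
eval-++ ((c , s) ∷ xs) ys n = trans (cong (λ t → c ℚ.* bracket s n ℚ.+ t) (eval-++ xs ys n))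
  (sym (ℚP.+-assoc (c ℚ.* bracket s n) (eval xs n) (eval ys n)))

negate : ∀ {l} → Poly l → Poly l
negate []            = []
negate ((m , e) ∷ p) = (- m , e) ∷ negate p

σ-sum-negate : ∀ {l} (p : Poly l) n → σ-sum (negate p) n ≡ - σ-sum p n
σ-sum-negate []            n = refl
σ-sum-negate ((m , e) ∷ p) n = trans
  (cong₂ _+_ (sym (ℤP.neg-distribˡ-* m (+ σ (Vec.toList e) n))) (σ-sum-negate p n))
  (sym (ℤP.neg-distrib-+ (m * + σ (Vec.toList e) n) (σ-sum p n)))

-- Relations in the graded quotient

admissible? : ∀ s → Dec (Admissible s)
admissible? []       = no λ ()
admissible? (s ∷ ss) = (2 ℕ.≤? s) ×-dec all? (1 ℕ.≤?_) ss

module _ (C : Certificate) (k : ℕ) where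
  open Certificate C

  lower : LinComb
  lower = toLinComb (negate L₂) ++ toLinComb (negate L₁)

  lower? : Dec (All (λ p → FilGen k 2 (proj₂ p)) lower)
  lower? = all? (λ (_ , s) → (≡-dec ℕ._≟_ s [] ⊎-dec admissible? s) ×-dec (sum s ℕ.≤? k) ×-dec (length s ℕ.≤? 2)) lower

  leading? : Dec (All (λ p → Admissible (proj₂ p) × weight (proj₂ p) ≡ k × length (proj₂ p) ≡ 3) (toLinComb L₃))
  leading? = all? (λ (_ , s) → admissible? s ×-dec (sum s ℕ.≟ k) ×-dec (length s ℕ.≟ 3)) (toLinComb L₃)

  eval-leading : ∀ n → eval (toLinComb L₃) n ≡ eval lower n
  eval-leading n = begin
    eval (toLinComb L₃) n
      ≡⟨ eval-toLinComb L₃ n ⟩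
    fromℤ (σ-sum L₃ n)
      ≡⟨ cong fromℤ solved ⟩
    fromℤ (σ-sum (negate L₂) n + σ-sum (negate L₁) n)
      ≡⟨ fromℤ-+ (σ-sum (negate L₂) n) (σ-sum (negate L₁) n) ⟩
    fromℤ (σ-sum (negate L₂) n) ℚ.+ fromℤ (σ-sum (negate L₁) n)
      ≡⟨ cong₂ ℚ._+_ (eval-toLinComb (negate L₂) n) (eval-toLinComb (negate L₁) n) ⟨
    eval (toLinComb (negate L₂)) n ℚ.+ eval (toLinComb (negate L₁)) n
      ≡⟨ eval-++ (toLinComb (negate L₂)) (toLinComb (negate L₁)) n ⟨
    eval lower n ∎
    where
    open ℤ-Solver
    solved : σ-sum L₃ n ≡ σ-sum (negate L₂) n + σ-sum (negate L₁) n
    solved = begin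
      σ-sum L₃ n
        ≡⟨ solve 3 (λ x y z → x := (x :+ (y :+ z)) :+ (:- y :+ :- z)) refl (σ-sum L₃ n) (σ-sum L₂ n) (σ-sum L₁ n) ⟩
      (σ-sum L₃ n + (σ-sum L₂ n + σ-sum L₁ n)) + (- σ-sum L₂ n + - σ-sum L₁ n)
        ≡⟨ cong₂ _+_ (σ-relation C n) (sym (cong₂ _+_ (σ-sum-negate L₂ n) (σ-sum-negate L₁ n))) ⟩
      0ℤ + (σ-sum (negate L₂) n + σ-sum (negate L₁) n)
        ≡⟨ ℤP.+-identityˡ _ ⟩
      σ-sum (negate L₂) n + σ-sum (negate L₁) n ∎

  grRelation : True leading? → True lower? → GrRelation k 3 (toLinComb L₃)
  grRelation leading low =
    -- The whole remainder has length at most 2, so 0 serves as the component of smaller weight.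
    toWitness leading , (λ _ → 0ℚ) , eval lower ,
    ([] , [] , λ _ → refl) , (lower , toWitness low , λ _ → refl) ,
    λ n → trans (eval-leading n) (sym (ℚP.+-identityˡ (eval lower n)))

-- Linear independence of the relations in weight 6

*-cancelʳ-zero : ∀ p q .{{_ : ℚ.NonZero q}} → p ℚ.* q ≡ 0ℚ → p ≡ 0ℚ
*-cancelʳ-zero p q pq≡0 = begin
  p                       ≡⟨ ℚP.*-identityʳ p ⟨
  p ℚ.* 1ℚ                ≡⟨ cong (p ℚ.*_) (ℚP.*-inverseʳ q) ⟨
  p ℚ.* (q ℚ.* ℚ.1/ q)    ≡⟨ ℚP.*-assoc p q (ℚ.1/ q) ⟨
  (p ℚ.* q) ℚ.* ℚ.1/ q    ≡⟨ cong (ℚ._* ℚ.1/ q) pq≡0 ⟩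
  0ℚ ℚ.* ℚ.1/ q           ≡⟨ ℚP.*-zeroˡ (ℚ.1/ q) ⟩
  0ℚ                      ∎

-- At `u` only `zs` contributes, which gives `c`; at `t` only `ys`, which gives `b`. With both zero,
-- the entry at `s` leaves only the multiple of `a`.
triangular⇒LinIndep3 : ∀ xs ys zs s t u →
  .{{_ : ℚ.NonZero (coeff xs s)}} .{{_ : ℚ.NonZero (coeff ys t)}} .{{_ : ℚ.NonZero (coeff zs u)}} →
  coeff xs t ≡ 0ℚ → coeff xs u ≡ 0ℚ → coeff ys u ≡ 0ℚ → coeff zs t ≡ 0ℚ → LinIndep3 xs ys zs
triangular⇒LinIndep3 xs ys zs s t u xt xu yu zt a b c dependent = a≡0 , b≡0 , c≡0
  where
  open ℚ-Solver
  c≡0 : c ≡ 0ℚ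
  c≡0 = *-cancelʳ-zero c (coeff zs u) (begin
    c ℚ.* coeff zs u
      ≡⟨ solve 3 (λ a b z → z := a :* con 0ℚ :+ b :* con 0ℚ :+ z) refl a b (c ℚ.* coeff zs u) ⟩
    a ℚ.* 0ℚ ℚ.+ b ℚ.* 0ℚ ℚ.+ c ℚ.* coeff zs u
      ≡⟨ cong₂ (λ x y → a ℚ.* x ℚ.+ b ℚ.* y ℚ.+ c ℚ.* coeff zs u) xu yu ⟨
    _ ≡⟨ dependent u ⟩
    0ℚ ∎)
  b≡0 : b ≡ 0ℚ
  b≡0 = *-cancelʳ-zero b (coeff ys t) (begin
    b ℚ.* coeff ys t
      ≡⟨ solve 3 (λ a c y → y := a :* con 0ℚ :+ y :+ c :* con 0ℚ) refl a c (b ℚ.* coeff ys t) ⟩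
    a ℚ.* 0ℚ ℚ.+ b ℚ.* coeff ys t ℚ.+ c ℚ.* 0ℚ
      ≡⟨ cong₂ (λ x z → a ℚ.* x ℚ.+ b ℚ.* coeff ys t ℚ.+ c ℚ.* z) xt zt ⟨
    _ ≡⟨ dependent t ⟩
    0ℚ ∎)
  a≡0 : a ≡ 0ℚ
  a≡0 = *-cancelʳ-zero a (coeff xs s) (begin
    a ℚ.* coeff xs s
      ≡⟨ solve 3 (λ x y z → x := x :+ con 0ℚ :* y :+ con 0ℚ :* z) refl (a ℚ.* coeff xs s) (coeff ys s) (coeff zs s) ⟩
    a ℚ.* coeff xs s ℚ.+ 0ℚ ℚ.* coeff ys s ℚ.+ 0ℚ ℚ.* coeff zs s
      ≡⟨ cong₂ (λ y z → a ℚ.* coeff xs s ℚ.+ y ℚ.* coeff ys s ℚ.+ z ℚ.* coeff zs s) b≡0 c≡0 ⟨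
    _ ≡⟨ dependent s ⟩
    0ℚ ∎)

mainTheorem7 : (Σ LinComb λ xs → GrRelation 5 3 xs × Nontrivial xs)
    × (Σ LinComb λ xs → Σ LinComb λ ys → Σ LinComb λ zs →
    GrRelation 6 3 xs × GrRelation 6 3 ys × GrRelation 6 3 zs
    × LinIndep3 xs ys zs)
mainTheorem7 =
  (toLinComb Weight5.L₃ , grRelation Weight5.certificate 5 _ _ , (3 ∷ 1 ∷ 1 ∷ []) , λ ()) ,
  toLinComb Weight6₁.L₃ , toLinComb Weight6₂.L₃ , toLinComb Weight6₃.L₃ ,
  grRelation Weight6₁.certificate 6 _ _ ,
  grRelation Weight6₂.certificate 6 _ _ ,
  grRelation Weight6₃.certificate 6 _ _ ,
  triangular⇒LinIndep3 (toLinComb Weight6₁.L₃) (toLinComb Weight6₂.L₃) (toLinComb Weight6₃.L₃)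
    -- [3,1,2] is the only bracket in the first relation, [2,2,2] occurs only in the second and
    -- [4,1,1] only in the third.
    (3 ∷ 1 ∷ 2 ∷ []) (2 ∷ 2 ∷ 2 ∷ []) (4 ∷ 1 ∷ 1 ∷ []) refl refl refl refl
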